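{- Satisfiability of E-flat formulae is decidable.
   Context: Logic: Presburger arithmetic over $\mathbb Z$ extended with free unary function symbols (array-ids) and cardinality terms. Terms: numerals $n\in\mathbb Z$, parameters (free constants, including a distinguished parameter $N$), individual variables, $t+t$, $-t$, $a(t)$ for an array-id $a$, and $\sharp\{x\mid\phi\}$. Atoms: $t<t$, $t=t$, $t\equiv_n t$. Formulae are built from atoms by $\wedge,\neg,\exists x$. Semantics: over the integers; each array-id $a$ is interpreted as a function $\mathbb Z\to\mathbb Z$ with $a(x)=0$ for $x\notin[0,N)$; $\sharp\{x\mid\phi\}$ denotes the cardinality of the set of $x\in[0,N)$ such that $\phi(x)$ holds (it binds $x$). Satisfiability means some assignment to parameters, free variables and array-ids (respecting these conventions) makes the formula true. An arithmetic formula is one containing neither array-ids nor $\sharp$. A basic formula is one obtained from an arithmetic formula by simultaneously replacing some free variables by terms $a(y)$ with $y$ a variable and $a$ an array-id. An E-flat formula is a formula of the form $\exists\underline z.\,\alpha\wedge\sharp\{x\mid\beta_1\}=z_1\wedge\cdots\wedge\sharp\{x\mid\beta_K\}=z_K$ with $\underline z=z_1,\dots,z_K$, where $\alpha,\beta_1,\dots,\beta_K$ are basic formulae and $x$ does not occur in $\alpha$. -}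

module Defs where

open import Data.Nat using (ℕ; zero; suc; NonZero)
open import Data.Integer using (ℤ; +_; -[1+_]; _+_; -_; _-_; _<_; _≤_; 0ℤ)
open import Data.Integer.Divisibility using (_∣_)
open import Data.List using (List; []; _∷_; length)
open import Data.List.Relation.Unary.All using (All)
open import Data.Product using (Σ; ∃; ∃₂; _×_; _,_)
open import Data.Sum using (_⊎_)
open import Relation.Nullary using (¬_)
open import Relation.Binary.PropositionalEquality using (_≡_)

-- Syntax.  Individual variables are de Bruijn indices (var i);
-- parameters are named by natural numbers (par k), and the
-- distinguished parameter N is parN; array-ids are natural numbers.
-- Both `ex φ` and `card φ` bind variable 0 in φ.

mutual
  data Term : Set where
    num  : ℤ → Term
    par  : ℕ → Term
    parN : Term
    var  : ℕ → Term
    _⊕_  : Term → Term → Term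
    ⊝_   : Term → Term
    app  : ℕ → Term → Term
    card : Formula → Term

  data Formula : Set where
    lt  : Term → Term → Formula
    eq  : Term → Term → Formula
    cng : (n : ℕ) → NonZero n → Term → Term → Formula
    and : Formula → Formula → Formula
    not : Formula → Formula
    ex  : Formula → Formula

record Model : Set where
  field
    params : ℕ → ℤ
    N      : ℤ
    arrays : ℕ → ℤ → ℤ
open Model public

ArraysOK : Model → Set
ArraysOK M = ∀ a i → (i < 0ℤ ⊎ N M ≤ i) → arrays M a i ≡ 0ℤ

_∷ᵉ_ : ℤ → (ℕ → ℤ) → (ℕ → ℤ)
(v ∷ᵉ ρ) zero    = v
(v ∷ᵉ ρ) (suc i) = ρ i

data Count (P : ℕ → Set) : ℕ → ℕ → Set where
  c-zero : Count P 0 0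
  c-yes  : ∀ {n k} → P n → Count P n k → Count P (suc n) (suc k)
  c-no   : ∀ {n k} → ¬ P n → Count P n k → Count P (suc n) k

-- size of [0,N) for an integer N
clamp : ℤ → ℕ
clamp (+ n)    = n
clamp -[1+ n ] = 0

mutual
  Eval : Model → (ℕ → ℤ) → Term → ℤ → Set
  Eval M ρ (num n)   v = v ≡ n
  Eval M ρ (par k)   v = v ≡ params M k
  Eval M ρ parN      v = v ≡ N M
  Eval M ρ (var i)   v = v ≡ ρ i
  Eval M ρ (s ⊕ t)   v = ∃₂ λ a b → Eval M ρ s a × Eval M ρ t b × v ≡ a + b
  Eval M ρ (⊝ t)     v = ∃ λ a → Eval M ρ t a × v ≡ - a
  Eval M ρ (app a t) v = ∃ λ u → Eval M ρ t u × v ≡ arrays M a u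
  Eval M ρ (card φ)  v =
    ∃ λ k → v ≡ + k × Count (λ n → Sat M ((+ n) ∷ᵉ ρ) φ) (clamp (N M)) k

  Sat : Model → (ℕ → ℤ) → Formula → Set
  Sat M ρ (lt s t)      = ∃₂ λ a b → Eval M ρ s a × Eval M ρ t b × a < b
  Sat M ρ (eq s t)      = ∃₂ λ a b → Eval M ρ s a × Eval M ρ t b × a ≡ b
  Sat M ρ (cng n _ s t) = ∃₂ λ a b → Eval M ρ s a × Eval M ρ t b × (+ n) ∣ (a - b)
  Sat M ρ (and φ ψ)     = Sat M ρ φ × Sat M ρ ψ
  Sat M ρ (not φ)       = ¬ Sat M ρ φ
  Sat M ρ (ex φ)        = ∃ λ (v : ℤ) → Sat M (v ∷ᵉ ρ) φ

Satisfiable : Formula → Set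
Satisfiable φ = Σ Model λ M → Σ (ℕ → ℤ) λ ρ → ArraysOK M × Sat M ρ φ

extʳ : (ℕ → ℕ) → (ℕ → ℕ)
extʳ r zero    = zero
extʳ r (suc i) = suc (r i)

mutual
  renT : (ℕ → ℕ) → Term → Term
  renT r (num n)   = num n
  renT r (par k)   = par k
  renT r parN      = parN
  renT r (var i)   = var (r i)
  renT r (s ⊕ t)   = renT r s ⊕ renT r t
  renT r (⊝ t)     = ⊝ renT r t
  renT r (app a t) = app a (renT r t)
  renT r (card φ)  = card (renF (extʳ r) φ)

  renF : (ℕ → ℕ) → Formula → Formula
  renF r (lt s t)      = lt (renT r s) (renT r t)
  renF r (eq s t)      = eq (renT r s) (renT r t)
  renF r (cng n p s t) = cng n p (renT r s) (renT r t)
  renF r (and φ ψ)     = and (renF r φ) (renF r ψ)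
  renF r (not φ)       = not (renF r φ)
  renF r (ex φ)        = ex (renF (extʳ r) φ)

extˢ : (ℕ → Term) → (ℕ → Term)
extˢ σ zero    = var zero
extˢ σ (suc i) = renT suc (σ i)

mutual
  subT : (ℕ → Term) → Term → Term
  subT σ (num n)   = num n
  subT σ (par k)   = par k
  subT σ parN      = parN
  subT σ (var i)   = σ i
  subT σ (s ⊕ t)   = subT σ s ⊕ subT σ t
  subT σ (⊝ t)     = ⊝ subT σ t
  subT σ (app a t) = app a (subT σ t)
  subT σ (card φ)  = card (subF (extˢ σ) φ)

  subF : (ℕ → Term) → Formula → Formula
  subF σ (lt s t)      = lt (subT σ s) (subT σ t)
  subF σ (eq s t)      = eq (subT σ s) (subT σ t)
  subF σ (cng n p s t) = cng n p (subT σ s) (subT σ t)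
  subF σ (and φ ψ)     = and (subF σ φ) (subF σ ψ)
  subF σ (not φ)       = not (subF σ φ)
  subF σ (ex φ)        = ex (subF (extˢ σ) φ)

mutual
  data ArithT : Term → Set where
    num  : ∀ n → ArithT (num n)
    par  : ∀ k → ArithT (par k)
    parN : ArithT parN
    var  : ∀ i → ArithT (var i)
    _⊕_  : ∀ {s t} → ArithT s → ArithT t → ArithT (s ⊕ t)
    ⊝_   : ∀ {t} → ArithT t → ArithT (⊝ t)

  data ArithF : Formula → Set where
    lt  : ∀ {s t} → ArithT s → ArithT t → ArithF (lt s t)
    eq  : ∀ {s t} → ArithT s → ArithT t → ArithF (eq s t)
    cng : ∀ {n p s t} → ArithT s → ArithT t → ArithF (cng n p s t)
    and : ∀ {φ ψ} → ArithF φ → ArithF ψ → ArithF (and φ ψ)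
    not : ∀ {φ} → ArithF φ → ArithF (not φ)
    ex  : ∀ {φ} → ArithF φ → ArithF (ex φ)

Basic : Formula → Set
Basic φ = Σ Formula λ ψ → Σ (ℕ → Term) λ σ →
            ArithF ψ
          × (∀ i → σ i ≡ var i ⊎ ∃₂ λ a y → σ i ≡ app a (var y))
          × φ ≡ subF σ ψ

exs : ℕ → Formula → Formula
exs zero    φ = φ
exs (suc k) φ = ex (exs k φ)

-- α ∧ ♯{x | β} = z ∧ …   (the j-th β of the list is paired with var (i + j))
flatBody : Formula → List Formula → ℕ → Formula
flatBody α []       i = α
flatBody α (β ∷ βs) i = and (flatBody α βs (suc i)) (eq (card β) (var i))

EFlat : Formula → Set
EFlat φ = Σ Formula λ α → Σ (List Formula) λ βs →
            Basic α × All Basic βs × φ ≡ exs (length βs) (flatBody α βs 0)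

{-# OPTIONS --safe #-}

-- The terms a(y) with y free become fresh variables, and β₁, …, β_K with x fixed and the
-- values a(x) quantified away become, for each 0/1-vector τ, a Presburger formula χ_τ(x, w)
-- saying that some values of the arrays at x realise τ.  The flat formula is then satisfiable
-- iff, for some w, each x ∈ [0, N) can be labelled by a τ with χ_τ(x, w) so that the labels
-- sum to z.  Such a sum is definable: in a language with floor division, a quantifier-free
-- χ(M q + r, w) depends, for a suitable period M, only on which of finitely many breakpoints
-- b(w) lie below q, so between breakpoints the allowed labels of a block of M consecutive
-- positions are constant and only the multiplicities of the labels matter.  The same
-- observation eliminates quantifiers: it suffices to test 0, b and b - 1 for q.

module Submission where

open import Defs
open import Data.Bool.Base using (Bool; true; false; if_then_else_)
open import Data.Empty using (⊥)
open import Data.Fin.Base using (Fin; zero; suc; toℕ; combine; remQuot)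
open import Data.Fin.Properties using (toℕ-fromℕ<; remQuot-combine)
open import Data.Integer.Base using (ℤ; +_; -[1+_]; _+_; _*_; -_; _-_; _≤_; _<_; 0ℤ; 1ℤ; -1ℤ; +≤+; _/ℕ_; _%ℕ_)
import Data.Integer.Base as ℤ
open import Data.Integer.Divisibility using (_∣_)
import Data.Integer.Divisibility.Signed as Signed
open import Data.Integer.DivMod using ([n/ℕd]*d≤n; n<s[n/ℕd]*d; n%ℕd<d; a≡a%ℕn+[a/ℕn]*n)
open import Data.Integer.Properties as ℤₚ using (≤-refl; ≤-reflexive; ≤-trans; ≤-antisym; <⇒≤; ≰⇒>; ≮⇒≥; <-≤-trans; ≤-<-trans)
open import Data.Integer.Tactic.RingSolver using (solve-∀)
open import Data.List.Base using (List; []; _∷_; _++_; upTo; length; replicate; concat; map; applyDownFrom; cartesianProductWith)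
open import Data.List.Membership.Propositional using (_∈_; find; lose)
open import Data.List.Membership.Propositional.Properties using (∈-upTo⁺; ∈-map⁺; ∈-map⁻; ∈-++⁺ˡ; ∈-++⁺ʳ; ∈-cartesianProductWith⁺; ∈-cartesianProductWith⁻)
open import Data.List.Properties using (length-++; length-replicate; length-applyDownFrom)
open import Data.List.Relation.Unary.All as All using (All; []; _∷_)
open import Data.List.Relation.Unary.All.Properties using (++⁺; ++⁻ˡ; ++⁻ʳ; replicate⁺)
open import Data.List.Relation.Unary.Any using (Any; here; there; satisfied)
open import Data.Maybe.Base using (Maybe; just; nothing; maybe′)
open import Data.Nat.Base as ℕ using (ℕ; zero; suc; NonZero)
import Data.Nat.DivMod as ℕ
import Data.Nat.Properties as ℕₚ
open import Data.Product using (Σ; ∃; ∃₂; _×_; _,_; proj₁; proj₂)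
open import Data.Product.Function.NonDependent.Propositional using (_×-⇔_)
open import Data.Sum.Base using (_⊎_; inj₁; inj₂; [_,_])
open import Data.Sum.Function.Propositional using (_⊎-⇔_)
open import Data.Vec.Base as Vec using (Vec; []; _∷_)
open import Data.Vec.Properties using (lookup∘tabulate)
open import Function.Base using (_∘_; case_of_)
open import Function.Bundles using (_⇔_; mk⇔; module Equivalence)
open import Function.Properties.Equivalence using () renaming (refl to ⇔-refl; sym to ⇔-sym; trans to ⇔-trans)
open import Function.Related.TypeIsomorphisms using (¬-cong-⇔)
open import Relation.Binary.PropositionalEquality using (_≡_; _≗_; refl; sym; trans; cong; cong₂; subst; subst₂; module ≡-Reasoning)
open import Relation.Nullary using (Dec; yes; no; ¬_; contradiction; does)
open import Relation.Nullary.Decidable as Dec using (_×-dec_; _⊎-dec_; ¬?)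

open Equivalence using (to; from)

-- Flatness makes positions independent: once the variables have values, β₁, ..., β_K at x read the
-- arrays only at x and at finitely many fixed y, so the column of array values at x can be chosen
-- without regard to the columns elsewhere.
--
-- The values a(y) that became variables are assigned independently, so two equal y could a priori
-- carry different values of a. But every y in [0, N) is itself a position that receives a label,
-- and χ_τ demands that the column at x equal the values a(y) for every y = x. This restores
-- functional consistency; outside [0, N) the values are required to be 0.
--
-- A labelling has unbounded length and is no object over which the language can quantify. The
-- integers that count how often each label occurs on a piece replace it; how many of them there are
-- does not depend on w. Floor division keeps breakpoints such as the ceiling of -s/c inside the
-- language, so elimination never leaves it. Quantifier-free formulae are decidable at each
-- environment, which also supplies the case distinctions of the constructive argument.

-- Integer inequalities and floor division

-- Moves the order part of an argument into a known inequality; what is left is an identity between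
-- differences, which the ring solver can do.
≤-by : ∀ {a b c d} → a ≤ b → b - a ≡ d - c → c ≤ d
≤-by a≤b e = ℤₚ.0≤i-j⇒j≤i (subst (0ℤ ≤_) e (ℤₚ.i≤j⇒0≤j-i a≤b))

<⇒1+≤ : ∀ {a b} → a < b → 1ℤ + a ≤ b
<⇒1+≤ = ℤₚ.i<j⇒suc[i]≤j

1+≤⇒< : ∀ {a b} → 1ℤ + a ≤ b → a < b
1+≤⇒< = ℤₚ.suc[i]≤j⇒i<j

<1+⇒≤ : ∀ {a b} → a < 1ℤ + b → a ≤ b
<1+⇒≤ {a} {b} p = ≤-by (<⇒1+≤ p) (cancel a b)
  where
  cancel : ∀ a b → (1ℤ + b) - (1ℤ + a) ≡ b - a
  cancel = solve-∀

-- The Galois connection between multiplication and floor division; through it bounds on a quotient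
-- become linear inequalities and back.
≤/ℕ⇔*≤ : ∀ x a d .{{_ : NonZero d}} → x ≤ a /ℕ d ⇔ x * + d ≤ a
≤/ℕ⇔*≤ x a d@(suc _) = mk⇔
  (λ p → ≤-trans (ℤₚ.*-monoʳ-≤-nonNeg (+ d) p) ([n/ℕd]*d≤n a d))
  (λ p → <1+⇒≤ (ℤₚ.*-cancelʳ-<-nonNeg (+ d) (≤-<-trans p (n<s[n/ℕd]*d a d))))

[a+d*k]/ℕd : ∀ a d k .{{_ : NonZero d}} → (a + + d * k) /ℕ d ≡ a /ℕ d + k
[a+d*k]/ℕd a d k = ≤-antisym
  (≤-by (from (≤/ℕ⇔*≤ _ a d) (≤-by ([n/ℕd]*d≤n (a + + d * k) d) (lower a (+ d) k ((a + + d * k) /ℕ d))))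
        (shift (a /ℕ d) ((a + + d * k) /ℕ d) k))
  (from (≤/ℕ⇔*≤ _ (a + + d * k) d)
        (≤-by ([n/ℕd]*d≤n a d) (upper a (+ d) k (a /ℕ d))))
  where
  lower : ∀ a d k p → (a + d * k) - p * d ≡ a - (p - k) * d
  lower = solve-∀
  shift : ∀ x p k → x - (p - k) ≡ x + k - p
  shift = solve-∀
  upper : ∀ a d k x → a - x * d ≡ (a + d * k) - (x + k) * d
  upper = solve-∀

-- Terms with floor division, and what they define

Env : Set → Set
Env V = V → ℤ

infixr 5 _▸_
_▸_ : {V : Set} → ℤ → Env V → Env (Maybe V)
(x ▸ w) = maybe′ w x

-- t ÷1+ d is the quotient of t by d + 1, rounded down.
data Tm (V : Set) : Set where
  con   : ℤ → Tm V
  at    : V → Tm V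
  _⊞_   : Tm V → Tm V → Tm V
  _⊠_   : ℤ → Tm V → Tm V
  _÷1+_ : Tm V → ℕ → Tm V

⟦_⟧ᵗ : {V : Set} → Tm V → Env V → ℤ
⟦ con c ⟧ᵗ   w = c
⟦ at v ⟧ᵗ    w = w v
⟦ t ⊞ u ⟧ᵗ   w = ⟦ t ⟧ᵗ w + ⟦ u ⟧ᵗ w
⟦ c ⊠ t ⟧ᵗ   w = c * ⟦ t ⟧ᵗ w
⟦ t ÷1+ d ⟧ᵗ w = ⟦ t ⟧ᵗ w /ℕ suc d

data QF (V : Set) : Set where
  nonneg : Tm V → QF V
  _⋀_    : QF V → QF V → QF V
  _⋁_    : QF V → QF V → QF V
  ∼_     : QF V → QF V

⟦_⟧ : {V : Set} → QF V → Env V → Set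
⟦ nonneg t ⟧ w = 0ℤ ≤ ⟦ t ⟧ᵗ w
⟦ φ ⋀ ψ ⟧    w = ⟦ φ ⟧ w × ⟦ ψ ⟧ w
⟦ φ ⋁ ψ ⟧    w = ⟦ φ ⟧ w ⊎ ⟦ ψ ⟧ w
⟦ ∼ φ ⟧      w = ¬ ⟦ φ ⟧ w

⟦_⟧? : {V : Set} (φ : QF V) (w : Env V) → Dec (⟦ φ ⟧ w)
⟦ nonneg t ⟧? w = 0ℤ ℤₚ.≤? ⟦ t ⟧ᵗ w
⟦ φ ⋀ ψ ⟧?    w = ⟦ φ ⟧? w ×-dec ⟦ ψ ⟧? w
⟦ φ ⋁ ψ ⟧?    w = ⟦ φ ⟧? w ⊎-dec ⟦ ψ ⟧? w
⟦ ∼ φ ⟧?      w = ¬? (⟦ φ ⟧? w)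

subᵗ : {V W : Set} → (V → Tm W) → Tm V → Tm W
subᵗ σ (con c)   = con c
subᵗ σ (at v)    = σ v
subᵗ σ (t ⊞ u)   = subᵗ σ t ⊞ subᵗ σ u
subᵗ σ (c ⊠ t)   = c ⊠ subᵗ σ t
subᵗ σ (t ÷1+ d) = subᵗ σ t ÷1+ d

sub : {V W : Set} → (V → Tm W) → QF V → QF W
sub σ (nonneg t) = nonneg (subᵗ σ t)
sub σ (φ ⋀ ψ)    = sub σ φ ⋀ sub σ ψ
sub σ (φ ⋁ ψ)    = sub σ φ ⋁ sub σ ψ
sub σ (∼ φ)      = ∼ sub σ φ

⟦subᵗ⟧ : {V W : Set} (σ : V → Tm W) {w : Env W} {w′ : Env V} → (∀ v → ⟦ σ v ⟧ᵗ w ≡ w′ v) →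
         ∀ t → ⟦ subᵗ σ t ⟧ᵗ w ≡ ⟦ t ⟧ᵗ w′
⟦subᵗ⟧ σ e (con c)   = refl
⟦subᵗ⟧ σ e (at v)    = e v
⟦subᵗ⟧ σ e (t ⊞ u)   = cong₂ _+_ (⟦subᵗ⟧ σ e t) (⟦subᵗ⟧ σ e u)
⟦subᵗ⟧ σ e (c ⊠ t)   = cong (c *_) (⟦subᵗ⟧ σ e t)
⟦subᵗ⟧ σ e (t ÷1+ d) = cong (_/ℕ suc d) (⟦subᵗ⟧ σ e t)

⟦sub⟧ : {V W : Set} (σ : V → Tm W) {w : Env W} {w′ : Env V} → (∀ v → ⟦ σ v ⟧ᵗ w ≡ w′ v) →
        ∀ φ → ⟦ sub σ φ ⟧ w ⇔ ⟦ φ ⟧ w′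
⟦sub⟧ σ e (nonneg t) = mk⇔ (subst (0ℤ ≤_) (⟦subᵗ⟧ σ e t)) (subst (0ℤ ≤_) (sym (⟦subᵗ⟧ σ e t)))
⟦sub⟧ σ e (φ ⋀ ψ)    = ⟦sub⟧ σ e φ ×-⇔ ⟦sub⟧ σ e ψ
⟦sub⟧ σ e (φ ⋁ ψ)    = ⟦sub⟧ σ e φ ⊎-⇔ ⟦sub⟧ σ e ψ
⟦sub⟧ σ e (∼ φ)      = ¬-cong-⇔ (⟦sub⟧ σ e φ)

-- V is usually infinite, but a formula mentions finitely many variables. The measure is a parameter
-- because three are used: the constant 0, for which agreement is pointwise equality, and below
-- `codeSize` and `cellIndex`.
module Bounded {V : Set} (size : V → ℕ) where

  boundᵗ : Tm V → ℕ
  boundᵗ (con c)   = 0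
  boundᵗ (at v)    = size v
  boundᵗ (t ⊞ u)   = boundᵗ t ℕ.⊔ boundᵗ u
  boundᵗ (c ⊠ t)   = boundᵗ t
  boundᵗ (t ÷1+ d) = boundᵗ t

  bound : QF V → ℕ
  bound (nonneg t) = boundᵗ t
  bound (φ ⋀ ψ)    = bound φ ℕ.⊔ bound ψ
  bound (φ ⋁ ψ)    = bound φ ℕ.⊔ bound ψ
  bound (∼ φ)      = bound φ

  AgreeUpTo : ℕ → Env V → Env V → Set
  AgreeUpTo n w w′ = ∀ v → size v ℕ.≤ n → w v ≡ w′ v

  ⟦⟧ᵗ-agree : ∀ t {n w w′} → boundᵗ t ℕ.≤ n → AgreeUpTo n w w′ → ⟦ t ⟧ᵗ w ≡ ⟦ t ⟧ᵗ w′
  ⟦⟧ᵗ-agree (con c)   b e = refl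
  ⟦⟧ᵗ-agree (at v)    b e = e v b
  ⟦⟧ᵗ-agree (t ⊞ u)   b e = cong₂ _+_ (⟦⟧ᵗ-agree t (ℕₚ.m⊔n≤o⇒m≤o _ _ b) e)
                                      (⟦⟧ᵗ-agree u (ℕₚ.m⊔n≤o⇒n≤o _ _ b) e)
  ⟦⟧ᵗ-agree (c ⊠ t)   b e = cong (c *_) (⟦⟧ᵗ-agree t b e)
  ⟦⟧ᵗ-agree (t ÷1+ d) b e = cong (_/ℕ suc d) (⟦⟧ᵗ-agree t b e)

  ⟦⟧-agree : ∀ φ {n w w′} → bound φ ℕ.≤ n → AgreeUpTo n w w′ → ⟦ φ ⟧ w ⇔ ⟦ φ ⟧ w′
  ⟦⟧-agree (nonneg t) b e = let e′ = ⟦⟧ᵗ-agree t b e in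
    mk⇔ (subst (0ℤ ≤_) e′) (subst (0ℤ ≤_) (sym e′))
  ⟦⟧-agree (φ ⋀ ψ)    b e = ⟦⟧-agree φ (ℕₚ.m⊔n≤o⇒m≤o _ _ b) e ×-⇔ ⟦⟧-agree ψ (ℕₚ.m⊔n≤o⇒n≤o _ _ b) e
  ⟦⟧-agree (φ ⋁ ψ)    b e = ⟦⟧-agree φ (ℕₚ.m⊔n≤o⇒m≤o _ _ b) e ⊎-⇔ ⟦⟧-agree ψ (ℕₚ.m⊔n≤o⇒n≤o _ _ b) e
  ⟦⟧-agree (∼ φ)      b e = ¬-cong-⇔ (⟦⟧-agree φ b e)

⟦⟧-ext : {V : Set} (φ : QF V) {w w′ : Env V} → w ≗ w′ → ⟦ φ ⟧ w ⇔ ⟦ φ ⟧ w′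
⟦⟧-ext φ e = Bounded.⟦⟧-agree (λ _ → 0) φ ℕₚ.≤-refl (λ v _ → e v)

-- Definable functions and predicates

-- `Lin` and `Def` are structure on semantic functions and predicates, so that later constructions
-- are plain Agda types and the closure lemmas assemble the formulae. Despite its name, `Lin` admits
-- floor division.
record Lin {V : Set} (f : Env V → ℤ) : Set where
  constructor mkLin
  field
    term    : Tm V
    term-≡  : ∀ w → ⟦ term ⟧ᵗ w ≡ f w
open Lin

record Def {V : Set} (P : Env V → Set) : Set where
  constructor mkDef
  field
    formula   : QF V
    formula-⇔ : ∀ w → ⟦ formula ⟧ w ⇔ P w
open Def

l-con : {V : Set} (c : ℤ) → Lin {V} (λ _ → c)
l-con c = mkLin (con c) (λ _ → refl)

l-at : {V : Set} (v : V) → Lin (λ w → w v)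
l-at v = mkLin (at v) (λ _ → refl)

l-tm : {V : Set} (t : Tm V) → Lin ⟦ t ⟧ᵗ
l-tm t = mkLin t (λ _ → refl)

module _ {V : Set} {f g : Env V → ℤ} where

  l-+ : Lin f → Lin g → Lin (λ w → f w + g w)
  l-+ F G = mkLin (term F ⊞ term G) (λ w → cong₂ _+_ (term-≡ F w) (term-≡ G w))

  l-resp : (∀ w → f w ≡ g w) → Lin f → Lin g
  l-resp e F = mkLin (term F) (λ w → trans (term-≡ F w) (e w))

module _ {V : Set} {f : Env V → ℤ} where

  l-* : ∀ c → Lin f → Lin (λ w → c * f w)
  l-* c F = mkLin (c ⊠ term F) (λ w → cong (c *_) (term-≡ F w))

  l-/ : ∀ d .{{_ : NonZero d}} → Lin f → Lin (λ w → f w /ℕ d)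
  l-/ (suc d) F = mkLin (term F ÷1+ d) (λ w → cong (_/ℕ suc d) (term-≡ F w))

  l-neg : Lin f → Lin (λ w → - f w)
  l-neg F = l-resp (λ w → ℤₚ.-1*i≡-i (f w)) (l-* -1ℤ F)

l-- : {V : Set} {f g : Env V → ℤ} → Lin f → Lin g → Lin (λ w → f w - g w)
l-- F G = l-+ F (l-neg G)

l-sub : {V W : Set} {f : Env V → ℤ} {s : Env W → Env V} →
        (∀ v → Lin (λ w → s w v)) → Lin f → Lin (λ w → f (s w))
l-sub S F = mkLin (subᵗ (term ∘ S) (term F))
  (λ w → trans (⟦subᵗ⟧ (term ∘ S) (λ v → term-≡ (S v) w) (term F)) (term-≡ F _))

l-wk : {V : Set} {f : Env V → ℤ} → Lin f → Lin {Maybe V} (λ w → f (w ∘ just))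
l-wk F = l-sub (λ v → l-at (just v)) F

d-resp : {V : Set} {P Q : Env V → Set} → (∀ w → P w ⇔ Q w) → Def P → Def Q
d-resp e D = mkDef (formula D) (λ w → ⇔-trans (formula-⇔ D w) (e w))

d-qf : {V : Set} (φ : QF V) → Def ⟦ φ ⟧
d-qf φ = mkDef φ (λ _ → ⇔-refl)

def-dec : {V : Set} {P : Env V → Set} → Def P → ∀ w → Dec (P w)
def-dec D w = Dec.map (formula-⇔ D w) (⟦ formula D ⟧? w)

-- Takes the place of function extensionality when an environment is taken apart and put together
-- again.
def-ext : {V : Set} {P : Env V → Set} → Def P → ∀ {w w′} → w ≗ w′ → P w → P w′
def-ext D e = to (formula-⇔ D _) ∘ to (⟦⟧-ext (formula D) e) ∘ from (formula-⇔ D _)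

d-sub : {V W : Set} {P : Env V → Set} {s : Env W → Env V} →
        (∀ v → Lin (λ w → s w v)) → Def P → Def (λ w → P (s w))
d-sub S D = mkDef (sub (term ∘ S) (formula D))
  (λ w → ⇔-trans (⟦sub⟧ (term ∘ S) (λ v → term-≡ (S v) w) (formula D)) (formula-⇔ D _))

module _ {V : Set} {f g : Env V → ℤ} where

  d-≤ : Lin f → Lin g → Def (λ w → f w ≤ g w)
  d-≤ F G = mkDef (nonneg (term D)) (λ w → mk⇔
    (λ p → ℤₚ.0≤i-j⇒j≤i (subst (0ℤ ≤_) (term-≡ D w) p))
    (λ p → subst (0ℤ ≤_) (sym (term-≡ D w)) (ℤₚ.i≤j⇒0≤j-i p)))
    where D = l-- G F

module _ {V : Set} {P Q : Env V → Set} where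

  d-× : Def P → Def Q → Def (λ w → P w × Q w)
  d-× D E = mkDef (formula D ⋀ formula E) (λ w → formula-⇔ D w ×-⇔ formula-⇔ E w)

  d-⊎ : Def P → Def Q → Def (λ w → P w ⊎ Q w)
  d-⊎ D E = mkDef (formula D ⋁ formula E) (λ w → formula-⇔ D w ⊎-⇔ formula-⇔ E w)

d-¬ : {V : Set} {P : Env V → Set} → Def P → Def (λ w → ¬ P w)
d-¬ D = mkDef (∼ formula D) (λ w → ¬-cong-⇔ (formula-⇔ D w))

d-→ : {V : Set} {P Q : Env V → Set} → Def P → Def Q → Def (λ w → P w → Q w)
d-→ D E = d-resp
  (λ w → mk⇔ [ (λ ¬p p → contradiction p ¬p) , (λ q _ → q) ]
             -- The classical direction, available because a definable `P` is decidable.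
             (λ h → case def-dec D w of λ { (yes p) → inj₂ (h p) ; (no ¬p) → inj₁ ¬p }))
  (d-⊎ (d-¬ D) E)

module _ {V : Set} {f g : Env V → ℤ} where

  d-≡ : Lin f → Lin g → Def (λ w → f w ≡ g w)
  d-≡ F G = d-resp
    (λ w → mk⇔ (λ { (p , q) → ≤-antisym p q }) (λ e → ≤-reflexive e , ≤-reflexive (sym e)))
    (d-× (d-≤ F G) (d-≤ G F))

  d-< : Lin f → Lin g → Def (λ w → f w < g w)
  d-< F G = d-resp (λ w → mk⇔ ≰⇒> ℤₚ.<⇒≱) (d-¬ (d-≤ G F))

module _ {V : Set} where

  d-⊤ : Def {V} (λ _ → 0ℤ ≤ 0ℤ)
  d-⊤ = d-≤ (l-con 0ℤ) (l-con 0ℤ)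

  d-Any : {A : Set} {P : A → Env V → Set} → (∀ a → Def (P a)) →
          ∀ as → Def (λ w → Any (λ a → P a w) as)
  d-Any D []       = d-resp (λ w → mk⇔ (λ ¬⊤ → contradiction ≤-refl ¬⊤) (λ ())) (d-¬ d-⊤)
  d-Any D (a ∷ as) = d-resp
    (λ w → mk⇔ [ here , there ] (λ { (here p) → inj₁ p ; (there p) → inj₂ p }))
    (d-⊎ (D a) (d-Any D as))

  d-∀Fin : ∀ {n} {P : Fin n → Env V → Set} → (∀ i → Def (P i)) → Def (λ w → ∀ i → P i w)
  d-∀Fin {zero}  D = d-resp (λ w → mk⇔ (λ _ ()) (λ _ → ≤-refl)) d-⊤
  d-∀Fin {suc n} D = d-resp
    (λ w → mk⇔ (λ { (p , q) zero → p ; (p , q) (suc i) → q i }) (λ h → h zero , h ∘ suc))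
    (d-× (D zero) (d-∀Fin (D ∘ suc)))

-- Quantifier elimination

-- Products serve as common multiples. A division by d + 1 multiplies the period by d + 1, which
-- makes the increment of the dividend divisible.
per : {V : Set} → Tm (Maybe V) → ℕ
per (con c)   = 1
per (at v)    = 1
per (t ⊞ u)   = per t ℕ.* per u
per (c ⊠ t)   = per t
per (t ÷1+ d) = suc d ℕ.* per t

-- The increment of the term when its variable `nothing` grows by `per t`. A division leaves it
-- unchanged, as the longer period makes up for the divisor.
slope : {V : Set} → Tm (Maybe V) → ℤ
slope (con c)       = 0ℤ
slope (at nothing)  = 1ℤ
slope (at (just v)) = 0ℤ
slope (t ⊞ u)       = slope t * + per u + slope u * + per t
slope (c ⊠ t)       = c * slope t
slope (t ÷1+ d)     = slope t

-- Terms are affine along progressions of step `per t`: at each division the dividend grows by a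
-- multiple of the divisor, which leaves the quotient exactly by `[a+d*k]/ℕd`.
⟦⟧ᵗ-shift : {V : Set} (t : Tm (Maybe V)) (x k : ℤ) (w : Env V) →
            ⟦ t ⟧ᵗ ((x + + per t * k) ▸ w) ≡ ⟦ t ⟧ᵗ (x ▸ w) + slope t * k
⟦⟧ᵗ-shift (con c)       x k w = lemma c k
  where
  lemma : ∀ c k → c ≡ c + 0ℤ * k
  lemma = solve-∀
⟦⟧ᵗ-shift (at nothing)  x k w = refl
⟦⟧ᵗ-shift (at (just v)) x k w = lemma (w v) k
  where
  lemma : ∀ c k → c ≡ c + 0ℤ * k
  lemma = solve-∀
⟦⟧ᵗ-shift (t ⊞ u) x k w = begin
  ⟦ t ⟧ᵗ ((x + + (p ℕ.* q) * k) ▸ w) + ⟦ u ⟧ᵗ ((x + + (p ℕ.* q) * k) ▸ w)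
    ≡⟨ cong₂ (λ a b → ⟦ t ⟧ᵗ ((x + a) ▸ w) + ⟦ u ⟧ᵗ ((x + b) ▸ w))
         (trans (cong (_* k) (ℤₚ.pos-* p q)) (ℤₚ.*-assoc (+ p) (+ q) k))
         (trans (cong (_* k) (ℤₚ.pos-* p q)) (swap (+ p) (+ q) k)) ⟩
  ⟦ t ⟧ᵗ ((x + + p * (+ q * k)) ▸ w) + ⟦ u ⟧ᵗ ((x + + q * (+ p * k)) ▸ w)
    ≡⟨ cong₂ _+_ (⟦⟧ᵗ-shift t x (+ q * k) w) (⟦⟧ᵗ-shift u x (+ p * k) w) ⟩
  (⟦ t ⟧ᵗ (x ▸ w) + slope t * (+ q * k)) + (⟦ u ⟧ᵗ (x ▸ w) + slope u * (+ p * k))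
    ≡⟨ collect (⟦ t ⟧ᵗ (x ▸ w)) (⟦ u ⟧ᵗ (x ▸ w)) (slope t) (slope u) (+ p) (+ q) k ⟩
  (⟦ t ⟧ᵗ (x ▸ w) + ⟦ u ⟧ᵗ (x ▸ w)) + (slope t * + q + slope u * + p) * k ∎
  where
  open ≡-Reasoning
  p = per t
  q = per u
  swap : ∀ p q k → p * q * k ≡ q * (p * k)
  swap = solve-∀
  collect : ∀ a b s s′ p q k →
            (a + s * (q * k)) + (b + s′ * (p * k)) ≡ (a + b) + (s * q + s′ * p) * k
  collect = solve-∀
⟦⟧ᵗ-shift (c ⊠ t) x k w =
  trans (cong (c *_) (⟦⟧ᵗ-shift t x k w)) (lemma c (⟦ t ⟧ᵗ (x ▸ w)) (slope t) k)
  where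
  lemma : ∀ c a s k → c * (a + s * k) ≡ c * a + c * s * k
  lemma = solve-∀
⟦⟧ᵗ-shift (t ÷1+ d) x k w = begin
  ⟦ t ⟧ᵗ ((x + + (suc d ℕ.* p) * k) ▸ w) /ℕ suc d
    ≡⟨ cong (λ a → ⟦ t ⟧ᵗ ((x + a) ▸ w) /ℕ suc d)
         (trans (cong (_* k) (ℤₚ.pos-* (suc d) p)) (swap (+ suc d) (+ p) k)) ⟩
  ⟦ t ⟧ᵗ ((x + + p * (+ suc d * k)) ▸ w) /ℕ suc d
    ≡⟨ cong (_/ℕ suc d) (⟦⟧ᵗ-shift t x (+ suc d * k) w) ⟩
  (⟦ t ⟧ᵗ (x ▸ w) + slope t * (+ suc d * k)) /ℕ suc d
    ≡⟨ cong (λ a → (⟦ t ⟧ᵗ (x ▸ w) + a) /ℕ suc d) (swap′ (slope t) (+ suc d) k) ⟩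
  (⟦ t ⟧ᵗ (x ▸ w) + + suc d * (slope t * k)) /ℕ suc d
    ≡⟨ [a+d*k]/ℕd (⟦ t ⟧ᵗ (x ▸ w)) (suc d) (slope t * k) ⟩
  ⟦ t ⟧ᵗ (x ▸ w) /ℕ suc d + slope t * k ∎
  where
  open ≡-Reasoning
  p = per t
  swap : ∀ p q k → p * q * k ≡ q * (p * k)
  swap = solve-∀
  swap′ : ∀ p q k → p * (q * k) ≡ q * (p * k)
  swap′ = solve-∀

-- Predicates that change only at breakpoints

Agree : {V : Set} → List (Tm V) → Env V → ℤ → ℤ → Set
Agree B w q q′ = All (λ b → ⟦ b ⟧ᵗ w ≤ q ⇔ ⟦ b ⟧ᵗ w ≤ q′) B

-- One direction is enough for an equivalence because `Agree` is symmetric; closure under negation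
-- rests on this.
record Thr {V : Set} (P : ℤ → Env V → Set) : Set where
  constructor mkThr
  field
    breaks : List (Tm V)
    stable : ∀ w q q′ → Agree breaks w q q′ → P q w → P q′ w
open Thr

module _ {V : Set} {P Q : ℤ → Env V → Set} where

  thr-× : Thr P → Thr Q → Thr (λ q w → P q w × Q q w)
  thr-× S T = mkThr (breaks S ++ breaks T) λ { w q q′ a (p , p′) →
    stable S w q q′ (++⁻ˡ (breaks S) a) p , stable T w q q′ (++⁻ʳ (breaks S) a) p′ }

  thr-⊎ : Thr P → Thr Q → Thr (λ q w → P q w ⊎ Q q w)
  thr-⊎ S T = mkThr (breaks S ++ breaks T) λ
    { w q q′ a (inj₁ p) → inj₁ (stable S w q q′ (++⁻ˡ (breaks S) a) p)
    ; w q q′ a (inj₂ p) → inj₂ (stable T w q q′ (++⁻ʳ (breaks S) a) p) }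

  thr-resp : (∀ q w → P q w ⇔ Q q w) → Thr P → Thr Q
  thr-resp e S = mkThr (breaks S) λ w q q′ a → to (e q′ w) ∘ stable S w q q′ a ∘ from (e q w)

thr-¬ : {V : Set} {P : ℤ → Env V → Set} → Thr P → Thr (λ q w → ¬ P q w)
thr-¬ S = mkThr (breaks S) λ w q q′ a ¬p p → ¬p (stable S w q′ q (All.map ⇔-sym a) p)

thr-affine : {V : Set} (s : Tm V) (c : ℤ) → Thr (λ q w → 0ℤ ≤ ⟦ s ⟧ᵗ w + c * q)
thr-affine s (+ zero) = mkThr [] λ w q q′ _ → subst (0ℤ ≤_) (lemma (⟦ s ⟧ᵗ w) q q′)
  where
  lemma : ∀ s q q′ → s + 0ℤ * q ≡ s + 0ℤ * q′
  lemma = solve-∀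
-- With coefficient c > 0, the inequality says that -q is at most floor(s/c), so the breakpoint is
-- -floor(s/c), the ceiling of -s/c.
thr-affine s (+ suc c) = mkThr (((-1ℤ) ⊠ (s ÷1+ c)) ∷ []) λ
  { w q q′ (a ∷ []) → from (flip w q′) ∘ to a ∘ to (flip w q) }
  where
  e₁ : ∀ s c q → (s + c * q) - 0ℤ ≡ s - (- q) * c
  e₁ = solve-∀
  e₂ : ∀ a q → a - (- q) ≡ q - (-1ℤ) * a
  e₂ = solve-∀
  flip : ∀ w q → (0ℤ ≤ ⟦ s ⟧ᵗ w + + suc c * q) ⇔ (-1ℤ * (⟦ s ⟧ᵗ w /ℕ suc c) ≤ q)
  flip w q = mk⇔
    (λ p → ≤-by (from (≤/ℕ⇔*≤ (- q) (⟦ s ⟧ᵗ w) (suc c)) (≤-by p (e₁ (⟦ s ⟧ᵗ w) (+ suc c) q)))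
                (e₂ _ q))
    (λ p → ≤-by (to (≤/ℕ⇔*≤ (- q) (⟦ s ⟧ᵗ w) (suc c)) (≤-by p (sym (e₂ _ q))))
                (sym (e₁ (⟦ s ⟧ᵗ w) (+ suc c) q)))
-- With coefficient -c < 0, the inequality says that q is at most floor(s/c). The breakpoint
-- floor(s/c) + 1 is the first q that fails, hence the negation.
thr-affine s -[1+ c ] = thr-resp flip (thr-¬ (mkThr ((s ÷1+ c) ⊞ con 1ℤ ∷ []) λ { w q q′ (a ∷ []) → to a }))
  where
  e₁ : ∀ s c q → (s + (- c) * q) - 0ℤ ≡ s - q * c
  e₁ = solve-∀
  flip : ∀ q w → (¬ (⟦ s ⟧ᵗ w /ℕ suc c + 1ℤ ≤ q)) ⇔ (0ℤ ≤ ⟦ s ⟧ᵗ w + -[1+ c ] * q)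
  flip q w = mk⇔
    (λ p → ≤-by (to (≤/ℕ⇔*≤ q (⟦ s ⟧ᵗ w) (suc c))
                    (<1+⇒≤ (subst (q <_) (ℤₚ.+-comm (⟦ s ⟧ᵗ w /ℕ suc c) 1ℤ) (≰⇒> p))))
                (sym (e₁ (⟦ s ⟧ᵗ w) (+ suc c) q)))
    (λ p q≥ → ℤₚ.<⇒≱ (1+≤⇒< (subst (_≤ q) (ℤₚ.+-comm (⟦ s ⟧ᵗ w /ℕ suc c) 1ℤ) q≥))
                (from (≤/ℕ⇔*≤ q (⟦ s ⟧ᵗ w) (suc c)) (≤-by p (e₁ (⟦ s ⟧ᵗ w) (+ suc c) q))))

period : {V : Set} → QF (Maybe V) → ℕ
period (nonneg t) = per t
period (φ ⋀ ψ)    = period φ ℕ.* period ψ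
period (φ ⋁ ψ)    = period φ ℕ.* period ψ
period (∼ φ)      = period φ

per-nonZero : {V : Set} (t : Tm (Maybe V)) → NonZero (per t)
per-nonZero (con c)   = _
per-nonZero (at v)    = _
per-nonZero (t ⊞ u)   = ℕₚ.m*n≢0 _ _ {{per-nonZero t}} {{per-nonZero u}}
per-nonZero (c ⊠ t)   = per-nonZero t
per-nonZero (t ÷1+ d) = ℕₚ.m*n≢0 (suc d) _ {{_}} {{per-nonZero t}}

period-nonZero : {V : Set} (φ : QF (Maybe V)) → NonZero (period φ)
period-nonZero (nonneg t) = per-nonZero t
period-nonZero (φ ⋀ ψ)    = ℕₚ.m*n≢0 _ _ {{period-nonZero φ}} {{period-nonZero ψ}}
period-nonZero (φ ⋁ ψ)    = ℕₚ.m*n≢0 _ _ {{period-nonZero φ}} {{period-nonZero ψ}}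
period-nonZero (∼ φ)      = period-nonZero φ

OnClass : {V : Set} → QF (Maybe V) → ℕ → ℤ → ℤ → Env V → Set
OnClass φ M r q w = ⟦ φ ⟧ ((+ M * q + r) ▸ w)

*-assocʳ : ∀ {M} m n k → M ≡ m ℕ.* n ℕ.* k → M ≡ m ℕ.* (n ℕ.* k)
*-assocʳ m n k e = trans e (ℕₚ.*-assoc m n k)

*-swapʳ : ∀ {M} m n k → M ≡ m ℕ.* n ℕ.* k → M ≡ n ℕ.* (m ℕ.* k)
*-swapʳ m n k e = trans e (trans (cong (ℕ._* k) (ℕₚ.*-comm m n)) (ℕₚ.*-assoc n m k))

-- The modulus is any multiple of the period, so that both parts of a connective can be treated with
-- the same M; `k` collects the cofactor.
thr-class : {V : Set} (φ : QF (Maybe V)) {M : ℕ} (k : ℕ) (r : ℤ) → M ≡ period φ ℕ.* k → Thr (OnClass φ M r)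
thr-class {V} (nonneg t) k r refl = thr-resp
  (λ q w → mk⇔ (subst (0ℤ ≤_) (e q w)) (subst (0ℤ ≤_) (sym (e q w))))
  (thr-affine (subᵗ σ t) (slope t * + k))
  where
  σ : Maybe V → Tm V
  σ nothing  = con r
  σ (just v) = at v
  ⟦σ⟧ : ∀ w v → ⟦ σ v ⟧ᵗ w ≡ (r ▸ w) v
  ⟦σ⟧ w nothing  = refl
  ⟦σ⟧ w (just v) = refl
  swap : ∀ p k q r → p * k * q + r ≡ r + p * (k * q)
  swap = solve-∀
  e : ∀ q w → ⟦ subᵗ σ t ⟧ᵗ w + slope t * + k * q ≡ ⟦ t ⟧ᵗ ((+ (per t ℕ.* k) * q + r) ▸ w)
  e q w = begin
    ⟦ subᵗ σ t ⟧ᵗ w + slope t * + k * q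
      ≡⟨ cong₂ _+_ (⟦subᵗ⟧ σ (⟦σ⟧ w) t) (ℤₚ.*-assoc (slope t) (+ k) q) ⟩
    ⟦ t ⟧ᵗ (r ▸ w) + slope t * (+ k * q)
      ≡⟨ ⟦⟧ᵗ-shift t r (+ k * q) w ⟨
    ⟦ t ⟧ᵗ ((r + + per t * (+ k * q)) ▸ w)
      ≡⟨ cong (λ x → ⟦ t ⟧ᵗ (x ▸ w)) (swap (+ per t) (+ k) q r) ⟨
    ⟦ t ⟧ᵗ ((+ per t * + k * q + r) ▸ w)
      ≡⟨ cong (λ x → ⟦ t ⟧ᵗ ((x * q + r) ▸ w)) (ℤₚ.pos-* (per t) k) ⟨
    ⟦ t ⟧ᵗ ((+ (per t ℕ.* k) * q + r) ▸ w) ∎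
    where open ≡-Reasoning
thr-class (φ ⋀ ψ) k r e = thr-× (thr-class φ _ r (*-assocʳ (period φ) (period ψ) k e))
                                (thr-class ψ _ r (*-swapʳ (period φ) (period ψ) k e))
thr-class (φ ⋁ ψ) k r e = thr-⊎ (thr-class φ _ r (*-assocʳ (period φ) (period ψ) k e))
                                (thr-class ψ _ r (*-swapʳ (period φ) (period ψ) k e))
thr-class (∼ φ) k r e = thr-¬ (thr-class φ k r e)

candidates : {V : Set} → List (Tm V) → List (Tm V)
candidates []      = con 0ℤ ∷ []
candidates (b ∷ B) = b ∷ (b ⊞ con -1ℤ) ∷ candidates B

-- Suppose the new `b` separates `q` from the candidate `c` found for the rest. If c < b ≤ q then
-- `b`, and if q < b ≤ c then b - 1, lies between `c` and `q`; a breakpoint that does not separate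
-- `c` from `q` separates neither from a point between them.
candidate-agrees : {V : Set} (B : List (Tm V)) (w : Env V) (q : ℤ) →
                   ∃ λ c → c ∈ candidates B × Agree B w q (⟦ c ⟧ᵗ w)
candidate-agrees []      w q = con 0ℤ , here refl , []
candidate-agrees (b ∷ B) w q with candidate-agrees B w q
... | c , c∈ , a with ⟦ b ⟧ᵗ w ℤₚ.≤? q | ⟦ b ⟧ᵗ w ℤₚ.≤? ⟦ c ⟧ᵗ w
...   | yes p | yes p′ = c , there (there c∈) , mk⇔ (λ _ → p′) (λ _ → p) ∷ a
...   | no ¬p | no ¬p′ = c , there (there c∈) , mk⇔ (λ p → contradiction p ¬p) (λ p → contradiction p ¬p′) ∷ a
...   | yes p | no ¬p′ = b , here refl , mk⇔ (λ _ → ≤-refl) (λ _ → p) ∷ All.map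
        (λ e → mk⇔ (λ x → ≤-trans (to e x) (<⇒≤ (≰⇒> ¬p′))) (λ x → ≤-trans x p)) a
...   | no ¬p | yes p′ = b ⊞ con -1ℤ , there (here refl)
        , mk⇔ (λ p → contradiction p ¬p) (λ p → contradiction p (ℤₚ.<⇒≱ b-1<b))
          ∷ All.map (λ e → mk⇔ (λ x → ≤-trans x q≤b-1)
                               (λ x → from e (≤-trans x (≤-trans (<⇒≤ b-1<b) p′)))) a
        where
        bw = ⟦ b ⟧ᵗ w
        e₁ : ∀ b → 0ℤ ≡ b - (1ℤ + (b + -1ℤ))
        e₁ = solve-∀
        e₂ : ∀ b q → b - (1ℤ + q) ≡ (b + -1ℤ) - q
        e₂ = solve-∀
        b-1<b : bw + -1ℤ < bw
        b-1<b = 1+≤⇒< (≤-by (≤-refl {0ℤ}) (e₁ bw))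
        q≤b-1 : q ≤ bw + -1ℤ
        q≤b-1 = ≤-by (<⇒1+≤ (≰⇒> ¬p)) (e₂ bw q)

divMod : ∀ x M .{{_ : NonZero M}} → x ≡ + M * (x /ℕ M) + + (x %ℕ M)
divMod x M = trans (a≡a%ℕn+[a/ℕn]*n x M) (lemma (+ (x %ℕ M)) (x /ℕ M) (+ M))
  where
  lemma : ∀ r q M → r + q * M ≡ M * q + r
  lemma = solve-∀

-- In the manner of Cooper's elimination: a witness is split into remainder and quotient, the
-- remainder is enumerated and the quotient replaced by a candidate for its residue class.
d-∃qf : {V : Set} (φ : QF (Maybe V)) → Def (λ w → ∃ λ x → ⟦ φ ⟧ (x ▸ w))
d-∃qf {V} φ = d-resp
  (λ w → mk⇔ (λ h → let _ , h′ = satisfied h ; _ , h″ = satisfied h′ in _ , h″) (λ (x , p) → complete w x p))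
  (d-Any (λ r → d-Any (λ c → d-sub (S r c) (d-qf φ)) (candidates (B r))) (upTo M))
  where
  M = period φ
  instance
    M≢0 : NonZero M
    M≢0 = period-nonZero φ
  T : ∀ r → Thr (OnClass φ M (+ r))
  T r = thr-class φ 1 (+ r) (sym (ℕₚ.*-identityʳ M))
  B : ℕ → List (Tm V)
  B r = breaks (T r)
  S : ∀ r c v → Lin {V} (λ w → ((+ M * ⟦ c ⟧ᵗ w + + r) ▸ w) v)
  S r c nothing  = l-+ (l-* (+ M) (l-tm c)) (l-con (+ r))
  S r c (just v) = l-at v
  complete : ∀ w x → ⟦ φ ⟧ (x ▸ w) →
             Any (λ r → Any (λ c → OnClass φ M (+ r) (⟦ c ⟧ᵗ w) w) (candidates (B r))) (upTo M)
  complete w x p with candidate-agrees (B (x %ℕ M)) w (x /ℕ M)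
  ... | c , c∈ , a = lose (∈-upTo⁺ (n%ℕd<d x M)) (lose c∈
    (stable (T (x %ℕ M)) w (x /ℕ M) (⟦ c ⟧ᵗ w) a (subst (λ x → ⟦ φ ⟧ (x ▸ w)) (divMod x M) p)))

d-∃ : {V : Set} {P : Env (Maybe V) → Set} → Def P → Def (λ w → ∃ λ x → P (x ▸ w))
d-∃ D = d-resp
  (λ w → mk⇔ (λ (x , p) → x , to (formula-⇔ D _) p) (λ (x , p) → x , from (formula-⇔ D _) p))
  (d-∃qf (formula D))

d-∃Fin : ∀ n {V : Set} {P : Env (Fin n ⊎ V) → Set} → Def P →
         Def (λ w → ∃ λ (u : Fin n → ℤ) → P [ u , w ])
d-∃Fin zero D = d-resp
  (λ w → mk⇔ (λ p → ∅ , p) (λ (u , p) → def-ext D (λ { (inj₁ ()) ; (inj₂ v) → refl }) p))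
  (d-sub {s = λ w → [ ∅ , w ]} (λ { (inj₂ v) → l-at v }) D)
  where
  ∅ : Fin 0 → ℤ
  ∅ ()
d-∃Fin (suc n) {V} {P} D = d-resp
  (λ w → mk⇔
    (λ { (x , u , p) → cons x u , def-ext D (λ { (inj₁ zero) → refl ; (inj₁ (suc i)) → refl ; (inj₂ v) → refl }) p })
    (λ { (u , p) → u zero , u ∘ suc ,
         def-ext D (λ { (inj₁ zero) → refl ; (inj₁ (suc i)) → refl ; (inj₂ v) → refl }) p }))
  (d-∃ (d-∃Fin n (d-sub {s = s} S D)))
  where
  cons : ℤ → (Fin n → ℤ) → Fin (suc n) → ℤ
  cons x u zero    = x
  cons x u (suc i) = u i
  s : Env (Fin n ⊎ Maybe V) → Env (Fin (suc n) ⊎ V)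
  s w = [ cons (w (inj₂ nothing)) (w ∘ inj₁) , w ∘ inj₂ ∘ just ]
  S : ∀ v → Lin (λ w → s w v)
  S (inj₁ zero)    = l-at (inj₂ nothing)
  S (inj₁ (suc i)) = l-at (inj₁ i)
  S (inj₂ v)       = l-at (inj₂ (just v))

-- Walks

total : {A : Set} → (A → ℤ) → List A → ℤ
total f []       = 0ℤ
total f (a ∷ as) = f a + total f as

total-++ : {A : Set} (f : A → ℤ) (as bs : List A) → total f (as ++ bs) ≡ total f as + total f bs
total-++ f []       bs = sym (ℤₚ.+-identityˡ _)
total-++ f (a ∷ as) bs = trans (cong (_+_ (f a)) (total-++ f as bs)) (sym (ℤₚ.+-assoc (f a) _ _))

total-replicate : {A : Set} (f : A → ℤ) (k : ℕ) (a : A) → total f (replicate k a) ≡ + k * f a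
total-replicate f zero    a = refl
total-replicate f (suc k) a = trans (cong (_+_ (f a)) (total-replicate f k a)) (lemma (f a) (+ k))
  where
  lemma : ∀ x k → x + k * x ≡ (1ℤ + k) * x
  lemma = solve-∀

total-concat : {A : Set} (f : A → ℤ) (ass : List (List A)) → total (total f) ass ≡ total f (concat ass)
total-concat f []         = refl
total-concat f (as ∷ ass) =
  trans (cong (_+_ (total f as)) (total-concat f ass)) (sym (total-++ f as (concat ass)))

-- Walks list the last position first, so a suffix of length m carries the labels of the first m
-- positions. This is how a walk is cut.
splitAtLast : {A : Set} (as : List A) (m : ℕ) → m ℕ.≤ length as →
              ∃₂ λ bs cs → as ≡ bs ++ cs × length cs ≡ m
splitAtLast []       m m≤ = [] , [] , refl , sym (ℕₚ.n≤0⇒n≡0 m≤)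
splitAtLast (a ∷ as) m m≤ with ℕₚ.m≤n⇒m<n∨m≡n m≤
... | inj₂ m≡ = [] , a ∷ as , refl , sym m≡
... | inj₁ m< = let bs , cs , e , l = splitAtLast as m (ℕₚ.≤-pred m<) in
  a ∷ bs , cs , cong (a ∷_) e , l

-- The labels of the positions lo , … , lo + length as - 1, the last position first.
data Walk {A : Set} (R : ℤ → A → Set) (lo : ℤ) : List A → Set where
  []  : Walk R lo []
  _∷_ : ∀ {a as} → R (lo + + length as) a → Walk R lo as → Walk R lo (a ∷ as)

assoc-length : {A : Set} (lo : ℤ) (bs as : List A) → lo + + length as + + length bs ≡ lo + + length (bs ++ as)
assoc-length lo bs as = trans (ℤₚ.+-assoc lo _ _)
  (cong (_+_ lo) (trans (sym (ℤₚ.pos-+ (length as) (length bs)))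
    (cong +_ (trans (ℕₚ.+-comm (length as) (length bs)) (sym (length-++ bs))))))

module _ {A : Set} {R : ℤ → A → Set} {lo : ℤ} where

  walk-++ : ∀ {as bs} → Walk R lo as → Walk R (lo + + length as) bs → Walk R lo (bs ++ as)
  walk-++ p []                   = p
  walk-++ {as} p (_∷_ {as = bs} r q) = subst (λ x → R x _) (assoc-length lo bs as) r ∷ walk-++ p q

  walk-split : ∀ bs {as} → Walk R lo (bs ++ as) → Walk R lo as × Walk R (lo + + length as) bs
  walk-split []       p            = p , []
  walk-split (b ∷ bs) {as} (r ∷ p) = let p₁ , p₂ = walk-split bs p in
    p₁ , subst (λ x → R x b) (sym (assoc-length lo bs as)) r ∷ p₂

InRange : ℤ → ℤ → ℤ → Set
InRange lo hi x = lo ≤ x × x < hi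

top-inRange : ∀ lo n → InRange lo (lo + + suc n) (lo + + n)
top-inRange lo n = ℤₚ.i≤i+j lo (+ n) , ℤₚ.+-monoʳ-< lo (ℤ.+<+ (ℕₚ.n<1+n n))

inRange-suc : ∀ {lo n x} → InRange lo (lo + + n) x → InRange lo (lo + + suc n) x
inRange-suc {lo} {n} (p , q) = p , ℤₚ.<-trans q (proj₂ (top-inRange lo n))

walk-map : {A : Set} {R : ℤ → A → Set} {R′ : ℤ → A → Set} {lo : ℤ} {as : List A} →
           (∀ x a → InRange lo (lo + + length as) x → R x a → R′ x a) → Walk R lo as → Walk R′ lo as
walk-map f []      = []
walk-map f (r ∷ p) = f _ _ (top-inRange _ _) r ∷ walk-map (λ x a i → f x a (inRange-suc i)) p

module _ {A : Set} {R : ℤ → A → Set} {Q : A → Set} {lo : ℤ} where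

  walk⇒All : ∀ {as} → (∀ x a → InRange lo (lo + + length as) x → R x a → Q a) → Walk R lo as → All Q as
  walk⇒All f []      = []
  walk⇒All f (r ∷ p) = f _ _ (top-inRange _ _) r ∷ walk⇒All (λ x a i → f x a (inRange-suc i)) p

  All⇒walk : ∀ {as} → (∀ x a → InRange lo (lo + + length as) x → Q a → R x a) → All Q as → Walk R lo as
  All⇒walk f []      = []
  All⇒walk f (r ∷ p) = f _ _ (top-inRange _ _) r ∷ All⇒walk (λ x a i → f x a (inRange-suc i)) p

-- Labellings of a range and their sums

Rules : Set → Set → Set
Rules A V = List (A × QF (Maybe V))

Allowed : {A V : Set} → Rules A V → Env (Maybe V) → A → Set
Allowed ts v a = ∃ λ χ → (a , χ) ∈ ts × ⟦ χ ⟧ v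

Step : {A V : Set} → Rules A V → Env V → ℤ → A → Set
Step ts w x a = Allowed ts (x ▸ w) a

module _ {K : ℕ} where

  Weight : Set → Set
  Weight A = A → Fin K → ℤ

  Totals : {A : Set} → Weight A → List A → (Fin K → ℤ) → Set
  Totals wt as z = ∀ j → z j ≡ total (λ a → wt a j) as

  Reach : {A V : Set} → Weight A → Rules A V → Env V → ℤ → ℤ → (Fin K → ℤ) → Set
  Reach wt ts w lo hi z = ∃ λ as → Walk (Step ts w) lo as × lo + + length as ≡ hi × Totals wt as z

  -- Bag wt ts v n z: some n labels allowed at v have weight z; k is the
  -- multiplicity of the first label.
  Bag : {A V : Set} → Weight A → Rules A V → Env (Maybe V) → ℤ → (Fin K → ℤ) → Set
  Bag wt []             v n z = n ≡ 0ℤ × (∀ j → z j ≡ 0ℤ)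
  Bag wt ((a , χ) ∷ ts) v n z =
    ∃ λ k → 0ℤ ≤ k × (k ≡ 0ℤ ⊎ ⟦ χ ⟧ v) × Bag wt ts v (n - k) (λ j → z j - k * wt a j)

  module _ {A V : Set} (wt : Weight A) where

    bag⇒list : (ts : Rules A V) {v : Env (Maybe V)} {n : ℤ} {z : Fin K → ℤ} → Bag wt ts v n z →
               ∃ λ as → All (Allowed ts v) as × + length as ≡ n × Totals wt as z
    bag⇒list [] (n≡0 , z≡0) = [] , [] , sym n≡0 , z≡0
    bag⇒list ((a , χ) ∷ ts) {n = n} {z} (+ k , _ , ok , b) with bag⇒list ts b
    ... | as , ps , l , t = replicate k a ++ as , ++⁺ (first ok) (All.map (λ (χ , i , p) → χ , there i , p) ps)
          , length≡ , λ j → sym (totals j)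
      where
      first : + k ≡ 0ℤ ⊎ ⟦ χ ⟧ _ → All (Allowed ((a , χ) ∷ ts) _) (replicate k a)
      first (inj₁ refl) = []
      first (inj₂ p)    = replicate⁺ k (χ , here refl , p)
      cancel : ∀ k n → k + (n - k) ≡ n
      cancel = solve-∀
      length≡ : + length (replicate k a ++ as) ≡ n
      length≡ = trans (cong +_ (trans (length-++ (replicate k a)) (cong (ℕ._+ length as) (length-replicate k))))
                  (trans (ℤₚ.pos-+ k (length as)) (trans (cong (_+_ (+ k)) l) (cancel (+ k) n)))
      totals : ∀ j → total (λ a → wt a j) (replicate k a ++ as) ≡ z j
      totals j = trans (total-++ _ (replicate k a) as)
        (trans (cong₂ _+_ (total-replicate _ k a) (sym (t j))) (cancel (+ k * wt a j) (z j)))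

    bag-resp : (ts : Rules A V) {v : Env (Maybe V)} {n n′ : ℤ} {z z′ : Fin K → ℤ} → n ≡ n′ → z ≗ z′ →
               Bag wt ts v n z → Bag wt ts v n′ z′
    bag-resp []             refl e (n≡0 , z≡0)      = n≡0 , λ j → trans (sym (e j)) (z≡0 j)
    bag-resp ((a , χ) ∷ ts) refl e (k , k≥ , ok , b) =
      k , k≥ , ok , bag-resp ts refl (λ j → cong (_- k * wt a j) (e j)) b

    bag-empty : (ts : Rules A V) {v : Env (Maybe V)} {z : Fin K → ℤ} → (∀ j → z j ≡ 0ℤ) → Bag wt ts v 0ℤ z
    bag-empty []             e = refl , e
    bag-empty ((a , χ) ∷ ts) e =
      0ℤ , ≤-refl , inj₁ refl , bag-empty ts (λ j → cong (_- 0ℤ) (e j))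

    -- Only the multiplicity of the rule that allows `a` is raised.
    bag-add : (ts : Rules A V) {v : Env (Maybe V)} {n : ℤ} {z : Fin K → ℤ} {a : A} → Allowed ts v a →
              Bag wt ts v n z → Bag wt ts v (1ℤ + n) (λ j → wt a j + z j)
    bag-add ((a , χ) ∷ ts) {n = n} {z} (_ , here refl , p) (k , k≥ , ok , b) =
      1ℤ + k , ≤-trans k≥ (ℤₚ.i≤j+i k 1ℤ) , inj₂ p ,
      bag-resp ts (e₁ n k) (λ j → e₂ (z j) k (wt a j)) b
      where
      e₁ : ∀ n k → n - k ≡ 1ℤ + n - (1ℤ + k)
      e₁ = solve-∀
      e₂ : ∀ z k x → z - k * x ≡ x + z - (1ℤ + k) * x
      e₂ = solve-∀
    bag-add ((a , χ) ∷ ts) {n = n} {z} {a′} (χ′ , there i , p) (k , k≥ , ok , b) =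
      k , k≥ , ok , bag-resp ts (e 1ℤ n k) (λ j → e (wt a′ j) (z j) (k * wt a j)) (bag-add ts (χ′ , i , p) b)
      where
      e : ∀ x z y → x + (z - y) ≡ x + z - y
      e = solve-∀

    list⇒bag : (ts : Rules A V) {v : Env (Maybe V)} {as : List A} {z : Fin K → ℤ} →
               All (Allowed ts v) as → Totals wt as z → Bag wt ts v (+ length as) z
    list⇒bag ts []       t = bag-empty ts t
    list⇒bag ts (p ∷ ps) t = bag-resp ts refl (λ j → sym (t j)) (bag-add ts p (list⇒bag ts ps (λ _ → refl)))

    -- The range is cut at the breakpoints inside it, so that finally the same labels are
    -- allowed at all positions of a piece and only their multiplicities matter.
    Pieces : Rules A V → List (Tm V) → Env V → ℤ → ℤ → (Fin K → ℤ) → Set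
    Pieces ts []      w lo hi z = Bag wt ts (lo ▸ w) (hi - lo) z
    Pieces ts (b ∷ B) w lo hi z =
        ((⟦ b ⟧ᵗ w ≤ lo ⊎ hi ≤ ⟦ b ⟧ᵗ w) × Pieces ts B w lo hi z)
      ⊎ (lo ≤ ⟦ b ⟧ᵗ w × ⟦ b ⟧ᵗ w ≤ hi ×
         ∃ λ (u : Fin K → ℤ) → Pieces ts B w lo (⟦ b ⟧ᵗ w) u × Pieces ts B w (⟦ b ⟧ᵗ w) hi (λ j → z j - u j))

    -- The range belongs to the invariant: it is what fixes the side of the breakpoints already
    -- removed from the list.
    StableOn : Rules A V → List (Tm V) → Env V → ℤ → ℤ → Set
    StableOn ts B w lo hi = ∀ x x′ → InRange lo hi x → InRange lo hi x′ → Agree B w x x′ →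
                            ∀ {a} → Step ts w x a → Step ts w x′ a

    reach-++ : (ts : Rules A V) {w : Env V} {lo mid hi : ℤ} {z u : Fin K → ℤ} →
               Reach wt ts w lo mid u → Reach wt ts w mid hi (λ j → z j - u j) → Reach wt ts w lo hi z
    reach-++ ts {lo = lo} {z = z} {u} (as , p , refl , t) (bs , q , refl , s) =
      bs ++ as , walk-++ p q , sym (assoc-length lo bs as) , λ j →
        trans (e (z j) (u j)) (trans (cong₂ _+_ (s j) (t j)) (sym (total-++ _ bs as)))
      where
      e : ∀ z u → z ≡ z - u + u
      e = solve-∀

    reach-split : (ts : Rules A V) {w : Env V} {lo mid hi : ℤ} {z : Fin K → ℤ} → lo ≤ mid → mid ≤ hi →
                  Reach wt ts w lo hi z →
                  ∃ λ u → Reach wt ts w lo mid u × Reach wt ts w mid hi (λ j → z j - u j)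
    reach-split ts {lo = lo} {mid} {z = z} lo≤ ≤hi (as , p , refl , t) =
      _ , (cs , proj₁ ps , cs-end , λ _ → refl) ,
      (bs , subst (λ x → Walk _ x bs) cs-end (proj₂ ps)
          , trans (cong (_+ + length bs) (sym cs-end)) (trans (assoc-length lo bs cs) (cong (λ l → lo + + length l) (sym as≡)))
          , λ j → trans (cong (_- total (λ a → wt a j) cs)
                     (trans (t j) (trans (cong (total _) as≡) (total-++ _ bs cs))))
                   (cancel (total (λ a → wt a j) bs) (total (λ a → wt a j) cs)))
      where
      m : ℕ
      m = ℤ.∣ mid - lo ∣
      m≡ : + m ≡ mid - lo
      m≡ = ℤₚ.0≤i⇒+∣i∣≡i (ℤₚ.i≤j⇒0≤j-i lo≤)
      e₁ : ∀ lo mid l → (lo + l) - mid ≡ l - (mid - lo)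
      e₁ = solve-∀
      m≤ : m ℕ.≤ length as
      m≤ = ℤₚ.drop‿+≤+ (subst (_≤ + length as) (sym m≡) (≤-by ≤hi (e₁ lo mid (+ length as))))
      sp = splitAtLast as m m≤
      bs = proj₁ sp
      cs = proj₁ (proj₂ sp)
      as≡ : as ≡ bs ++ cs
      as≡ = proj₁ (proj₂ (proj₂ sp))
      ps = walk-split bs (subst (Walk _ lo) as≡ p)
      e₂ : ∀ lo mid → lo + (mid - lo) ≡ mid
      e₂ = solve-∀
      cs-end : lo + + length cs ≡ mid
      cs-end = trans (cong (λ l → lo + + l) (proj₂ (proj₂ (proj₂ sp)))) (trans (cong (_+_ lo) m≡) (e₂ lo mid))
      cancel : ∀ x y → x + y - y ≡ x
      cancel = solve-∀

    -- Ranges are half-open, so a breakpoint at either end does not divide them: if b ≤ lo′ then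
    -- every position is at least b, and if hi′ ≤ b then none is.
    stable-narrow : (ts : Rules A V) {w : Env V} (b : Tm V) {B : List (Tm V)} {lo lo′ hi hi′ : ℤ} →
                    lo ≤ lo′ → hi′ ≤ hi → (⟦ b ⟧ᵗ w ≤ lo′ ⊎ hi′ ≤ ⟦ b ⟧ᵗ w) →
                    StableOn ts (b ∷ B) w lo hi → StableOn ts B w lo′ hi′
    stable-narrow ts {w} b {lo′ = lo′} {hi′ = hi′} ≤lo hi≤ side st x x′ i i′ ag =
      st x x′ (widen i) (widen i′) (b-agrees side ∷ ag)
      where
      widen : ∀ {y} → InRange lo′ hi′ y → InRange _ _ y
      widen (p , q) = ≤-trans ≤lo p , <-≤-trans q hi≤
      b-agrees : (⟦ b ⟧ᵗ w ≤ lo′ ⊎ hi′ ≤ ⟦ b ⟧ᵗ w) → ⟦ b ⟧ᵗ w ≤ x ⇔ ⟦ b ⟧ᵗ w ≤ x′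
      b-agrees (inj₁ p) = mk⇔ (λ _ → ≤-trans p (proj₁ i′)) (λ _ → ≤-trans p (proj₁ i))
      b-agrees (inj₂ p) = mk⇔ (λ b≤ → contradiction b≤ (ℤₚ.<⇒≱ (<-≤-trans (proj₂ i) p)))
                              (λ b≤ → contradiction b≤ (ℤₚ.<⇒≱ (<-≤-trans (proj₂ i′) p)))

    -- The order of the breakpoints varies with `w`, so they are not sorted: each in turn is outside
    -- the range or cuts it, and both halves go on with the remaining ones.
    pieces⇔reach : (ts : Rules A V) (B : List (Tm V)) (w : Env V) {lo hi : ℤ} {z : Fin K → ℤ} →
                   StableOn ts B w lo hi → Pieces ts B w lo hi z ⇔ Reach wt ts w lo hi z
    pieces⇔reach ts [] w {lo} {hi} {z} st = mk⇔ f g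
      where
      e : ∀ lo hi → lo + (hi - lo) ≡ hi
      e = solve-∀
      e′ : ∀ lo n → n ≡ lo + n - lo
      e′ = solve-∀
      -- `lo` represents the range only if the range is non-empty, which the position at hand
      -- witnesses.
      lo-inRange : ∀ {x} → InRange lo hi x → InRange lo hi lo
      lo-inRange (p , q) = ≤-refl , ≤-<-trans p q
      f : Bag wt ts (lo ▸ w) (hi - lo) z → Reach wt ts w lo hi z
      f b with bag⇒list ts b
      ... | as , ps , l , t = as , All⇒walk (λ x a i → st lo x (lo-inRange (i′ i)) (i′ i) []) ps , end , t
        where
        end : lo + + length as ≡ hi
        end = trans (cong (_+_ lo) l) (e lo hi)
        i′ : ∀ {x} → InRange lo (lo + + length as) x → InRange lo hi x
        i′ {x} = subst (λ hi → InRange lo hi x) end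
      g : Reach wt ts w lo hi z → Bag wt ts (lo ▸ w) (hi - lo) z
      g (as , p , refl , t) = bag-resp ts (e′ lo (+ length as)) (λ _ → refl)
        (list⇒bag ts (walk⇒All (λ x a i → st x lo i (lo-inRange i) []) p) t)
    pieces⇔reach ts (b ∷ B) w {lo} {hi} {z} st = mk⇔ f g
      where
      c : ℤ
      c = ⟦ b ⟧ᵗ w
      below : lo ≤ c → c ≤ hi → StableOn ts B w lo c
      below _ c≤ = stable-narrow ts b ≤-refl c≤ (inj₂ ≤-refl) st
      above : lo ≤ c → c ≤ hi → StableOn ts B w c hi
      above ≤c _ = stable-narrow ts b ≤c ≤-refl (inj₁ ≤-refl) st
      outside : c ≤ lo ⊎ hi ≤ c → StableOn ts B w lo hi
      outside s = stable-narrow ts b ≤-refl ≤-refl s st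
      f : Pieces ts (b ∷ B) w lo hi z → Reach wt ts w lo hi z
      f (inj₁ (s , p))              = to (pieces⇔reach ts B w (outside s)) p
      f (inj₂ (≤c , c≤ , u , p , q)) = reach-++ ts (to (pieces⇔reach ts B w (below ≤c c≤)) p)
                                                  (to (pieces⇔reach ts B w (above ≤c c≤)) q)
      g : Reach wt ts w lo hi z → Pieces ts (b ∷ B) w lo hi z
      g r with c ℤₚ.≤? lo | hi ℤₚ.≤? c
      ... | yes p | _     = inj₁ (inj₁ p , from (pieces⇔reach ts B w (outside (inj₁ p))) r)
      ... | no _  | yes p = inj₁ (inj₂ p , from (pieces⇔reach ts B w (outside (inj₂ p))) r)
      ... | no p  | no q  =
        let ≤c = <⇒≤ (≰⇒> p) ; c≤ = <⇒≤ (≰⇒> q)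
            u , r₁ , r₂ = reach-split ts ≤c c≤ r
        in inj₂ (≤c , c≤ , u , from (pieces⇔reach ts B w (below ≤c c≤)) r₁
                            , from (pieces⇔reach ts B w (above ≤c c≤)) r₂)

    -- Stated under an arbitrary substitution `s` because each quantifier enlarges the environment
    -- while the count and the sums change along the recursion.
    d-Bag : (ts : Rules A V) {W : Set} {s : Env W → Env (Maybe V)} {n : Env W → ℤ} {z : Fin K → Env W → ℤ} →
            (∀ v → Lin (λ w → s w v)) → Lin n → (∀ j → Lin (z j)) → Def (λ w → Bag wt ts (s w) (n w) (λ j → z j w))
    d-Bag []             S N Z = d-× (d-≡ N (l-con 0ℤ)) (d-∀Fin (λ j → d-≡ (Z j) (l-con 0ℤ)))
    d-Bag ((a , χ) ∷ ts) {W} {s} {n} {z} S N Z = d-∃ {P = P}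
      (d-× (d-≤ (l-con 0ℤ) k)
        (d-× (d-⊎ (d-≡ k (l-con 0ℤ)) (d-sub (l-wk ∘ S) (d-qf χ)))
          (d-Bag ts (l-wk ∘ S) (l-- (l-wk N) k) (λ j → l-- (l-wk (Z j)) (k·wt j)))))
      where
      P : Env (Maybe W) → Set
      P w = let w′ = w ∘ just ; k = w nothing in
        0ℤ ≤ k × (k ≡ 0ℤ ⊎ ⟦ χ ⟧ (s w′)) × Bag wt ts (s w′) (n w′ - k) (λ j → z j w′ - k * wt a j)
      k : Lin {Maybe W} (λ w → w nothing)
      k = l-at nothing
      k·wt : ∀ j → Lin {Maybe W} (λ w → w nothing * wt a j)
      k·wt j = l-resp (λ w → ℤₚ.*-comm (wt a j) _) (l-* (wt a j) k)

    l-▸ : {W : Set} {x : Env W → ℤ} {s : Env W → Env V} → Lin x → (∀ v → Lin (λ w → s w v)) →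
          ∀ v → Lin (λ w → (x w ▸ s w) v)
    l-▸ X S nothing  = X
    l-▸ X S (just v) = S v

    d-Pieces : (ts : Rules A V) (B : List (Tm V)) {W : Set} {s : Env W → Env V} {lo hi : Env W → ℤ}
               {z : Fin K → Env W → ℤ} → (∀ v → Lin (λ w → s w v)) → Lin lo → Lin hi → (∀ j → Lin (z j)) →
               Def (λ w → Pieces ts B (s w) (lo w) (hi w) (λ j → z j w))
    d-Pieces ts []      S L H Z = d-Bag ts (l-▸ L S) (l-- H L) Z
    d-Pieces ts (b ∷ B) {W} {s} {lo} {hi} {z} S L H Z = d-⊎
      (d-× (d-⊎ (d-≤ b′ L) (d-≤ H b′)) (d-Pieces ts B S L H Z))
      (d-× (d-≤ L b′) (d-× (d-≤ b′ H)
        (d-∃Fin K {P = P} (d-×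
          (d-Pieces ts B (wk ∘ S) (wk L) (wk b′) (λ j → l-at (inj₁ j)))
          (d-Pieces ts B (wk ∘ S) (wk b′) (wk H) (λ j → l-- (wk (Z j)) (l-at (inj₁ j))))))))
      where
      b′ : Lin (λ w → ⟦ b ⟧ᵗ (s w))
      b′ = l-sub S (l-tm b)
      wk : {f : Env W → ℤ} → Lin f → Lin {Fin K ⊎ W} (λ w → f (w ∘ inj₂))
      wk = l-sub (λ v → l-at (inj₂ v))
      P : Env (Fin K ⊎ W) → Set
      P w = let w′ = w ∘ inj₂ ; u = w ∘ inj₁ in
        Pieces ts B (s w′) (lo w′) (⟦ b ⟧ᵗ (s w′)) u × Pieces ts B (s w′) (⟦ b ⟧ᵗ (s w′)) (hi w′) (λ j → z j w′ - u j)

  record Uniform {A V : Set} (ts : Rules A V) : Set where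
    constructor mkUniform
    field
      cuts  : List (Tm V)
      fixed : ∀ w q q′ → Agree cuts w q q′ → ∀ {a} → Step ts w q a → Step ts w q′ a
  open Uniform

  uniform : {A V : Set} {ts : Rules A V} → All (λ t → Thr (λ q w → ⟦ proj₂ t ⟧ (q ▸ w))) ts → Uniform ts
  uniform []       = mkUniform [] λ { w q q′ a (χ , () , p) }
  uniform (T ∷ Ts) = mkUniform (breaks T ++ cuts U) λ
    { w q q′ a (χ , here refl , p) → χ , here refl , stable T w q q′ (++⁻ˡ (breaks T) a) p
    ; w q q′ a (χ , there i , p)   →
        let χ′ , i′ , p′ = fixed U w q q′ (++⁻ʳ (breaks T) a) (χ , i , p) in χ′ , there i′ , p′ }
    where U = uniform Ts

  d-Reach-uniform : {A V W : Set} (wt : Weight A) {ts : Rules A V} → Uniform ts → {s : Env W → Env V}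
                    {lo hi : Env W → ℤ} {z : Fin K → Env W → ℤ} → (∀ v → Lin (λ w → s w v)) →
                    Lin lo → Lin hi → (∀ j → Lin (z j)) →
                    Def (λ w → Reach wt ts (s w) (lo w) (hi w) (λ j → z j w))
  d-Reach-uniform wt {ts} U S L H Z = d-resp
    (λ w → pieces⇔reach wt ts (cuts U) _ (λ x x′ _ _ a → fixed U _ x x′ a))
    (d-Pieces wt ts (cuts U) S L H Z)

-- Grouping the positions into blocks of length M

module Blocks {A V : Set} (M : ℕ) (ts : Rules A V) where

  class : ℕ → Maybe V → Tm (Maybe V)
  class r nothing  = ((+ M) ⊠ at nothing) ⊞ con (+ r)
  class r (just v) = at (just v)

  ⟦class⟧ : ∀ r χ q w → ⟦ sub (class r) χ ⟧ (q ▸ w) ⇔ ⟦ χ ⟧ ((+ M * q + + r) ▸ w)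
  ⟦class⟧ r χ q w = ⟦sub⟧ (class r) (λ { nothing → refl ; (just v) → refl }) χ

  extend : ℕ → A × QF (Maybe V) → List A × QF (Maybe V) → List A × QF (Maybe V)
  extend r (a , χ) (as , ψ) = a ∷ as , sub (class r) χ ⋀ ψ

  -- Rules for the first r positions of a block, as conditions on the block index. Full blocks use r
  -- = M, the incomplete block at the end of the range a smaller r.
  block : ℕ → Rules (List A) V
  block zero    = ([] , nonneg (con 0ℤ)) ∷ []
  block (suc r) = cartesianProductWith (extend r) ts (block r)

  block-sound : ∀ r {as ψ} {q : ℤ} {w : Env V} → (as , ψ) ∈ block r → ⟦ ψ ⟧ (q ▸ w) →
                length as ≡ r × Walk (Step ts w) (+ M * q) as
  block-sound zero    (here refl) p = refl , []
  block-sound (suc r) i p with ∈-cartesianProductWith⁻ (extend r) ts (block r) i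
  block-sound (suc r) {q = q} {w} i (p , p′) | (a , χ) , (as , ψ) , i₁ , i₂ , refl with block-sound r i₂ p′
  ... | refl , walk = refl , (χ , i₁ , to (⟦class⟧ r χ q w) p) ∷ walk

  block-complete : ∀ {as} {q : ℤ} {w : Env V} → Walk (Step ts w) (+ M * q) as →
                   Allowed (block (length as)) (q ▸ w) as
  block-complete [] = nonneg (con 0ℤ) , here refl , ≤-refl
  block-complete {a ∷ as} {q} {w} ((χ , i , p) ∷ walk) with block-complete walk
  ... | ψ , i′ , p′ = _ , ∈-cartesianProductWith⁺ (extend (length as)) i i′ , from (⟦class⟧ (length as) χ q w) p , p′

  M*suc : ∀ n → M ℕ.* n ℕ.+ M ≡ M ℕ.* suc n
  M*suc n = trans (ℕₚ.+-comm (M ℕ.* n) M) (sym (ℕₚ.*-suc M n))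

  position : ∀ n → 0ℤ + + (M ℕ.* n) ≡ + M * (0ℤ + + n)
  position n = trans (ℤₚ.+-identityˡ _) (trans (ℤₚ.pos-* M n) (cong (+ M *_) (sym (ℤₚ.+-identityˡ (+ n)))))

  -- Blocks and the labels inside them are both listed last first, so plain concatenation flattens a
  -- walk over blocks.
  walk-concat : ∀ {ass w} → Walk (Step (block M) w) 0ℤ ass →
                length (concat ass) ≡ M ℕ.* length ass × Walk (Step ts w) 0ℤ (concat ass)
  walk-concat [] = sym (ℕₚ.*-zeroʳ M) , []
  walk-concat {as ∷ ass} {w} ((ψ , i , p) ∷ walk) with walk-concat walk | block-sound M i p
  ... | l , walk′ | l′ , walk″ =
      trans (length-++ as) (trans (cong₂ ℕ._+_ l′ l) (trans (ℕₚ.+-comm M _) (M*suc (length ass))))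
    , walk-++ walk′ (subst (λ x → Walk (Step ts w) x as)
        (sym (trans (cong (λ n → 0ℤ + + n) l) (position (length ass)))) walk″)

  walk-chunk : ∀ n {as w} → length as ≡ M ℕ.* n → Walk (Step ts w) 0ℤ as →
               ∃ λ ass → concat ass ≡ as × length ass ≡ n × Walk (Step (block M) w) 0ℤ ass
  walk-chunk zero {[]}    l walk = [] , refl , refl , []
  walk-chunk zero {_ ∷ _} l walk = contradiction (trans l (ℕₚ.*-zeroʳ M)) λ ()
  walk-chunk (suc n) {as} {w} l walk
    with splitAtLast as (M ℕ.* n) (subst (M ℕ.* n ℕ.≤_) (sym l) (ℕₚ.*-monoʳ-≤ M (ℕₚ.n≤1+n n)))
  ... | bs , cs , refl , lc with walk-split bs walk
  ...   | walk₁ , walk₂ with walk-chunk n lc walk₁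
  ...     | ass , refl , refl , walk′ = bs ∷ ass , refl , refl , step ∷ walk′
    where
    lb : length bs ≡ M
    lb = ℕₚ.+-cancelʳ-≡ (M ℕ.* length ass) _ _
      (trans (cong (length bs ℕ.+_) (sym lc)) (trans (sym (length-++ bs)) (trans l (ℕₚ.*-suc M (length ass)))))
    step : Step (block M) w (0ℤ + + length ass) bs
    step = subst (λ r → Step (block r) w (0ℤ + + length ass) bs) lb
      (block-complete (subst (λ x → Walk (Step ts w) x bs)
        (trans (cong (λ n → 0ℤ + + n) lc) (position (length ass))) walk₂))

  -- A block formula is a conjunction of rules taken on residue classes, so only thresholds on the
  -- block index remain.
  block-thr : All (λ t → ∀ r → Thr (OnClass (proj₂ t) M (+ r))) ts →
              ∀ r → All (λ t → Thr (λ q w → ⟦ proj₂ t ⟧ (q ▸ w))) (block r)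
  block-thr T zero    = mkThr [] (λ w q q′ _ p → p) ∷ []
  block-thr T (suc r) = All.tabulate λ i → case ∈-cartesianProductWith⁻ (extend r) ts (block r) i of λ
    { (t , u , i₁ , i₂ , refl) → thr-×
        (thr-resp (λ q w → ⇔-sym (⟦class⟧ r (proj₂ t) q w)) (All.lookup T i₁ r))
        (All.lookup (block-thr T r) i₂) }

  -- The range consists of n / M full blocks and one incomplete block. Its length `r` selects a rule
  -- list and must be a numeral, hence the finite disjunction with an equation that singles out the
  -- true remainder.
  reach⇔blocks : ∀ {K} (wt : Weight {K} A) .{{_ : NonZero M}} (w : Env V) (n : ℤ) (z : Fin K → ℤ) →
    Reach wt ts w 0ℤ n z ⇔
    Any (λ r → n ≡ + M * (n /ℕ M) + + r × Any (λ t → ⟦ proj₂ t ⟧ ((n /ℕ M) ▸ w) ×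
          Reach (λ as j → total (λ a → wt a j) as) (block M) w 0ℤ (n /ℕ M)
                (λ j → z j - total (λ a → wt a j) (proj₁ t))) (block r)) (upTo M)
  reach⇔blocks wt w n z = mk⇔ f g
    where
    cancel : ∀ x y → x + y - x ≡ y
    cancel = solve-∀
    f : Reach wt ts w 0ℤ n z → _
    f (as , walk , refl , t)
      with splitAtLast as (M ℕ.* (length as ℕ./ M)) (subst (ℕ._≤ length as) (ℕₚ.*-comm _ M) (ℕ.m/n*n≤m (length as) M))
    ... | bs , cs , as≡ , lc with walk-split bs (subst (Walk (Step ts w) 0ℤ) as≡ walk)
    ...   | walk₁ , walk₂ with walk-chunk (length as ℕ./ M) lc walk₁
    ...     | ass , refl , la , walk′ = lose (∈-upTo⁺ (ℕ.m%n<n (length as) M))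
      (divMod _ M , lose (proj₁ (proj₂ rest)) (proj₂ (proj₂ rest) , ass , walk′ , cong +_ la , λ j →
        trans (cong (_- total (λ a → wt a j) bs)
          (trans (t j) (trans (cong (total _) as≡) (total-++ _ bs (concat ass)))))
          (trans (cancel (total _ bs) _) (sym (total-concat _ ass)))))
      where
      e : M ℕ.* (length as ℕ./ M) ℕ.+ length bs ≡ M ℕ.* (length as ℕ./ M) ℕ.+ length as ℕ.% M
      e = trans (cong (ℕ._+ length bs) (sym lc)) (trans (ℕₚ.+-comm (length (concat ass)) (length bs))
           (trans (sym (length-++ bs)) (trans (cong length (sym as≡))
             (trans (ℕ.m≡m%n+[m/n]*n (length as) M)
               (trans (ℕₚ.+-comm (length as ℕ.% M) _) (cong (ℕ._+ length as ℕ.% M) (ℕₚ.*-comm _ M)))))))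
      rest : Allowed (block (length as ℕ.% M)) (+ (length as ℕ./ M) ▸ w) bs
      rest = subst (λ r → Allowed (block r) (+ (length as ℕ./ M) ▸ w) bs)
        (ℕₚ.+-cancelˡ-≡ (M ℕ.* (length as ℕ./ M)) (length bs) (length as ℕ.% M) e)
        (block-complete (subst (λ x → Walk (Step ts w) x bs)
          (trans (cong +_ lc) (ℤₚ.pos-* M _)) walk₂))
    g : Any _ (upTo M) → Reach wt ts w 0ℤ n z
    g h with find h
    ... | r , _ , n≡ , h′ with find h′
    ...   | (bs , ψ) , i , p , ass , walk , l , t with block-sound r i p | walk-concat walk
    ...     | refl , walk₂ | lc , walk₁ = bs ++ concat ass
      , walk-++ walk₁ (subst (λ x → Walk (Step ts w) x bs) (sym at-cut) walk₂)
      , trans (sym (assoc-length 0ℤ bs (concat ass))) (trans (cong (_+ + length bs) at-cut) (sym n≡))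
      , λ j → trans (e (z j) (total _ bs)) (trans (cong (_+_ (total _ bs)) (trans (t j) (total-concat _ ass)))
                (sym (total-++ _ bs (concat ass))))
      where
      e : ∀ z x → z ≡ x + (z - x)
      e = solve-∀
      at-cut : 0ℤ + + length (concat ass) ≡ + M * (n /ℕ M)
      at-cut = trans (cong (λ n → 0ℤ + + n) lc) (trans (position (length ass)) (cong (+ M *_) l))

-- Definability of label sums over [0, n)

periods : {A V : Set} → Rules A V → ℕ
periods []             = 1
periods ((a , χ) ∷ ts) = period χ ℕ.* periods ts

periods-nonZero : {A V : Set} (ts : Rules A V) → NonZero (periods ts)
periods-nonZero []             = _
periods-nonZero ((a , χ) ∷ ts) = ℕₚ.m*n≢0 _ _ {{period-nonZero χ}} {{periods-nonZero ts}}

thr-periods : {A V : Set} (ts : Rules A V) {M : ℕ} (k : ℕ) → M ≡ periods ts ℕ.* k →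
              All (λ t → ∀ r → Thr (OnClass (proj₂ t) M (+ r))) ts
thr-periods []             k e = []
thr-periods ((a , χ) ∷ ts) k e =
    (λ r → thr-class χ _ (+ r) (*-assocʳ (period χ) (periods ts) k e))
  ∷ thr-periods ts _ (*-swapʳ (period χ) (periods ts) k e)

-- With M a common multiple of all periods the block rules are uniform in the block index; the lower
-- end 0 aligns block q with position M q.
d-Reach : {A V : Set} {K : ℕ} (wt : Weight {K} A) (ts : Rules A V) {n : Env V → ℤ} {z : Fin K → Env V → ℤ} →
          Lin n → (∀ j → Lin (z j)) → Def (λ w → Reach wt ts w 0ℤ (n w) (λ j → z j w))
d-Reach wt ts {n} {z} N Z = d-resp (λ w → ⇔-sym (reach⇔blocks wt w (n w) (λ j → z j w)))
  (d-Any (λ r → d-×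
     (d-≡ N (l-+ (l-* (+ M) Q) (l-con (+ r))))
     (d-Any (λ t → d-×
        (d-sub {s = λ w → (n w /ℕ M) ▸ w} (λ { nothing → Q ; (just v) → l-at v }) (d-qf (proj₂ t)))
        (d-Reach-uniform _ (uniform (block-thr thr-all M)) {s = λ w → w} l-at (l-con 0ℤ) Q
           (λ j → l-- (Z j) (l-con _))))
        (block r)))
     (upTo M))
  where
  M = periods ts
  open Blocks M ts
  instance
    M≢0 : NonZero M
    M≢0 = periods-nonZero ts
  thr-all : All (λ t → ∀ r → Thr (OnClass (proj₂ t) M (+ r))) ts
  thr-all = thr-periods ts 1 (sym (ℕₚ.*-identityʳ M))
  Q : Lin (λ w → n w /ℕ M)
  Q = l-/ M N

-- Basic formulae as quantifier-free formulae

-- Expresses congruence atoms by floor division.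
∣⇔quotient : ∀ n .{{_ : NonZero n}} x → (+ n ∣ x) ⇔ (x ≡ + n * (x /ℕ n))
∣⇔quotient n@(suc _) x = mk⇔ f (λ e → Signed.∣⇒∣ᵤ (Signed.divides (x /ℕ n) (trans e (ℤₚ.*-comm (+ n) _))))
  where
  f : + n ∣ x → x ≡ + n * (x /ℕ n)
  f d with Signed.∣ᵤ⇒∣ {+ n} {x} d
  ... | Signed.divides q refl = trans (ℤₚ.*-comm q (+ n)) (cong (+ n *_) (sym quotient))
    where
    quotient : (q * + n) /ℕ n ≡ q
    quotient = trans (cong (_/ℕ n) (trans (ℤₚ.*-comm q (+ n)) (sym (ℤₚ.+-identityˡ (+ n * q)))))
                 (trans ([a+d*k]/ℕd 0ℤ n q) (ℤₚ.+-identityˡ q))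

-- The symbols of the arithmetic formula before array reads are substituted. Quantifiers are
-- eliminated at this stage: a substituted a(y) never contains a bound variable, so it is a constant
-- to them.
data Sym : Set where
  sPar : ℕ → Sym
  sN   : Sym
  sVar : ℕ → Sym

symEnv : Model → (ℕ → ℤ) → Env Sym
symEnv M ρ (sPar k) = params M k
symEnv M ρ sN       = N M
symEnv M ρ (sVar i) = ρ i

bindSym : ℤ → Env Sym → Env Sym
bindSym x w (sVar zero)    = x
bindSym x w (sVar (suc i)) = w (sVar i)
bindSym x w (sPar k)       = w (sPar k)
bindSym x w sN             = w sN

bindSym-Lin : ∀ v → Lin {Maybe Sym} (λ w → bindSym (w nothing) (w ∘ just) v)
bindSym-Lin (sVar zero)    = l-at nothing
bindSym-Lin (sVar (suc i)) = l-at (just (sVar i))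
bindSym-Lin (sPar k)       = l-at (just (sPar k))
bindSym-Lin sN             = l-at (just sN)

FlatTerm : Model → (ℕ → ℤ) → Term → ℤ → Set
FlatTerm M ρ t x = (∃ λ k → t ≡ var k × x ≡ ρ k) ⊎ (∃₂ λ a y → t ≡ app a (var y) × x ≡ arrays M a (ρ y))

eval-flat : ∀ {M ρ t x} → FlatTerm M ρ t x → ∀ v → v ≡ x ⇔ Eval M ρ t v
eval-flat (inj₁ (k , refl , refl))     v = ⇔-refl
eval-flat (inj₂ (a , y , refl , refl)) v = mk⇔ (λ e → _ , refl , e) (λ { (_ , refl , e) → e })

ext-flat : ∀ M {ρ σ ρ′} x → (∀ i → FlatTerm M ρ (σ i) (ρ′ i)) →
           ∀ i → FlatTerm M (x ∷ᵉ ρ) (extˢ σ i) ((x ∷ᵉ ρ′) i)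
ext-flat M x h zero = inj₁ (0 , refl , refl)
ext-flat M x h (suc i) with h i
... | inj₁ (k , e , e′)     = inj₁ (suc k , cong (renT suc) e , e′)
... | inj₂ (a , y , e , e′) = inj₂ (a , suc y , cong (renT suc) e , e′)

TermTranslation : Term → Set
TermTranslation t = Σ (Tm Sym) λ t′ → ∀ {M ρ σ ρ′} → (∀ i → FlatTerm M ρ (σ i) (ρ′ i)) →
                    ∀ v → v ≡ ⟦ t′ ⟧ᵗ (symEnv M ρ′) ⇔ Eval M ρ (subT σ t) v

arithT : ∀ {t} → ArithT t → TermTranslation t
arithT (num n) = con n , λ _ _ → ⇔-refl
arithT (par k) = at (sPar k) , λ _ _ → ⇔-refl
arithT parN    = at sN , λ _ _ → ⇔-refl
arithT (var i) = at (sVar i) , λ h → eval-flat (h i)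
arithT (p ⊕ q) = let s , es = arithT p ; t , et = arithT q in s ⊞ t , λ h v → mk⇔
  (λ e → _ , _ , to (es h _) refl , to (et h _) refl , e)
  (λ { (_ , _ , x , y , e) → trans e (cong₂ _+_ (from (es h _) x) (from (et h _) y)) })
arithT (⊝ p)   = let s , es = arithT p in (-1ℤ) ⊠ s , λ h v → mk⇔
  (λ e → _ , to (es h _) refl , trans e (ℤₚ.-1*i≡-i _))
  (λ { (_ , x , e) → trans e (trans (cong -_ (from (es h _) x)) (sym (ℤₚ.-1*i≡-i _))) })

-- The translation is fixed before `σ`, `ρ` and the model are given, so the induction can pass under
-- a binder, where `ext-flat` supplies the shifted data.
FormulaTranslation : Formula → Set
FormulaTranslation ψ = Σ (QF Sym) λ ψ′ → ∀ {M ρ σ ρ′} → (∀ i → FlatTerm M ρ (σ i) (ρ′ i)) →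
                       ⟦ ψ′ ⟧ (symEnv M ρ′) ⇔ Sat M ρ (subF σ ψ)

atomT : (s t : Term) (R : ℤ → ℤ → Set) → (∀ {f g : Env Sym → ℤ} → Lin f → Lin g → Def (λ w → R (f w) (g w))) →
        TermTranslation s → TermTranslation t →
        Σ (QF Sym) λ ψ′ → ∀ {M ρ σ ρ′} → (∀ i → FlatTerm M ρ (σ i) (ρ′ i)) →
          ⟦ ψ′ ⟧ (symEnv M ρ′) ⇔ (∃₂ λ a b → Eval M ρ (subT σ s) a × Eval M ρ (subT σ t) b × R a b)
atomT _ _ R d (s , es) (t , et) = formula D , λ h → ⇔-trans (formula-⇔ D _) (mk⇔
  (λ r → _ , _ , to (es h _) refl , to (et h _) refl , r)
  (λ { (_ , _ , x , y , r) → subst₂ R (from (es h _) x) (from (et h _) y) r }))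
  where D = d (l-tm s) (l-tm t)

arithF : ∀ {ψ} → ArithF ψ → FormulaTranslation ψ
arithF (lt {s} {t} p q) = atomT s t _<_ d-< (arithT p) (arithT q)
arithF (eq {s} {t} p q) = atomT s t _≡_ d-≡ (arithT p) (arithT q)
arithF (cng {n} {n≢0} {s} {t} p q) = atomT s t (λ a b → + n ∣ (a - b))
  (λ F G → d-resp (λ w → ⇔-sym (∣⇔quotient n {{n≢0}} _))
             (d-≡ (l-- F G) (l-* (+ n) (l-/ n {{n≢0}} (l-- F G)))))
  (arithT p) (arithT q)
arithF (and p q) = let φ , eφ = arithF p ; ψ , eψ = arithF q in φ ⋀ ψ , λ h → eφ h ×-⇔ eψ h
arithF (not p)   = let φ , eφ = arithF p in ∼ φ , λ h → ¬-cong-⇔ (eφ h)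
arithF (ex p) with arithF p
... | φ , eφ = formula D , λ {M} {ρ} {σ} {ρ′} h → ⇔-trans (formula-⇔ D _) (mk⇔
  (λ { (x , s) → x , to (eφ (ext-flat M x h)) (to (⟦⟧-ext φ (bind≗ M ρ′ x)) s) })
  (λ { (x , s) → x , from (⟦⟧-ext φ (bind≗ M ρ′ x)) (from (eφ (ext-flat M x h)) s) }))
  where
  D : Def (λ w → ∃ λ x → ⟦ φ ⟧ (bindSym x w))
  D = d-∃ (d-sub bindSym-Lin (d-qf φ))
  bind≗ : ∀ M ρ′ x → bindSym x (symEnv M ρ′) ≗ symEnv M (x ∷ᵉ ρ′)
  bind≗ M ρ′ x (sVar zero)    = refl
  bind≗ M ρ′ x (sVar (suc i)) = refl
  bind≗ M ρ′ x (sPar k)       = refl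
  bind≗ M ρ′ x sN             = refl

-- cell a y is the value a(y) of an array-id at a variable.
data Cell : Set where
  cPar : ℕ → Cell
  cN   : Cell
  cVar : ℕ → Cell
  cell : ℕ → ℕ → Cell

cellEnv : Model → (ℕ → ℤ) → Env Cell
cellEnv M ρ (cPar k)   = params M k
cellEnv M ρ cN         = N M
cellEnv M ρ (cVar i)   = ρ i
cellEnv M ρ (cell a y) = arrays M a (ρ y)

cellEnv-cong : ∀ M {ρ ρ′} → ρ ≗ ρ′ → cellEnv M ρ ≗ cellEnv M ρ′
cellEnv-cong M e (cPar k)   = refl
cellEnv-cong M e cN         = refl
cellEnv-cong M e (cVar i)   = e i
cellEnv-cong M e (cell a y) = cong (arrays M a) (e y)

basic : ∀ {φ} → Basic φ → Σ (QF Cell) λ φ′ → ∀ M ρ → ⟦ φ′ ⟧ (cellEnv M ρ) ⇔ Sat M ρ φ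
basic (ψ , σ , p , flat , refl) with arithF p
... | φ , eφ = sub (at ∘ place) φ , λ M ρ →
  ⇔-trans (⟦sub⟧ (at ∘ place) (place≗ M ρ) φ) (eφ (fits M ρ))
  where
  varCell : ∀ {i} → σ i ≡ var i ⊎ (∃₂ λ a y → σ i ≡ app a (var y)) → Cell
  varCell {i} (inj₁ _)       = cVar i
  varCell (inj₂ (a , y , _)) = cell a y
  place : Sym → Cell
  place (sPar k) = cPar k
  place sN       = cN
  place (sVar i) = varCell (flat i)
  place≗ : ∀ M ρ v → cellEnv M ρ (place v) ≡ symEnv M (λ i → cellEnv M ρ (varCell (flat i))) v
  place≗ M ρ (sPar k) = refl
  place≗ M ρ sN       = refl
  place≗ M ρ (sVar i) = refl
  fits : ∀ M ρ i → FlatTerm M ρ (σ i) (cellEnv M ρ (varCell (flat i)))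
  fits M ρ i with flat i
  ... | inj₁ e           = inj₁ (i , e , refl)
  ... | inj₂ (a , y , e) = inj₂ (a , y , e , refl)

-- Flat bodies

count-map : ∀ {P Q : ℕ → Set} → (∀ n → P n ⇔ Q n) → ∀ {n k} → Count P n k → Count Q n k
count-map e c-zero       = c-zero
count-map e (c-yes p c)  = c-yes (to (e _) p) (count-map e c)
count-map e (c-no ¬p c)  = c-no (¬p ∘ from (e _)) (count-map e c)

Counted : Model → (ℕ → ℤ) → QF Cell → ℕ → Set
Counted M ρ φ i = ∃ λ k → ρ i ≡ + k × Count (λ n → ⟦ φ ⟧ (cellEnv M ((+ n) ∷ᵉ ρ))) (clamp (N M)) k

∷ᵉ-cong : ∀ x {ρ ρ′ : ℕ → ℤ} → ρ ≗ ρ′ → (x ∷ᵉ ρ) ≗ (x ∷ᵉ ρ′)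
∷ᵉ-cong x e zero    = refl
∷ᵉ-cong x e (suc i) = e i

counted-cong : ∀ {M ρ ρ′} φ i → ρ ≗ ρ′ → Counted M ρ φ i → Counted M ρ′ φ i
counted-cong {M} φ i e (k , e′ , c) =
  k , trans (sym (e i)) e′ , count-map (λ n → ⟦⟧-ext φ (cellEnv-cong M (∷ᵉ-cong (+ n) e))) c

-- The index i + j, accumulated in the same way as in `flatBody` so that the two recursions match.
countVar : ∀ {K} → ℕ → Fin K → ℕ
countVar i zero    = i
countVar i (suc j) = countVar (suc i) j

counters : ∀ {βs} → All Basic βs → Fin (length βs) → QF Cell
counters (b ∷ bs) zero    = proj₁ (basic b)
counters (b ∷ bs) (suc j) = counters bs j

FlatSat : ∀ {K} → Model → (ℕ → ℤ) → QF Cell → (Fin K → QF Cell) → ℕ → Set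
FlatSat M ρ α β i = ⟦ α ⟧ (cellEnv M ρ) × (∀ j → Counted M ρ (β j) (countVar i j))

flatBody⇔ : ∀ {α βs} (a : Basic α) (bs : All Basic βs) M ρ i →
            FlatSat M ρ (proj₁ (basic a)) (counters bs) i ⇔ Sat M ρ (flatBody α βs i)
flatBody⇔ a []       M ρ i = mk⇔ (λ { (p , _) → to (proj₂ (basic a) M ρ) p })
                                 (λ p → from (proj₂ (basic a) M ρ) p , λ ())
flatBody⇔ a (b ∷ bs) M ρ i = mk⇔
  (λ { (p , c) → to (flatBody⇔ a bs M ρ (suc i)) (p , c ∘ suc) ,
       (let k , e , c₀ = c zero in + k , ρ i , (k , refl , count-map same c₀) , refl , sym e) })
  (λ { (p , _ , _ , (k , refl , c₀) , refl , e) → let p′ , c = from (flatBody⇔ a bs M ρ (suc i)) p in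
       p′ , λ { zero → k , sym e , count-map (⇔-sym ∘ same) c₀ ; (suc j) → c j } })
  where
  same : ∀ n → ⟦ proj₁ (basic b) ⟧ (cellEnv M ((+ n) ∷ᵉ ρ)) ⇔ Sat M ((+ n) ∷ᵉ ρ) _
  same n = proj₂ (basic b) M ((+ n) ∷ᵉ ρ)

Respects≗ : Model → Formula → Set
Respects≗ M ψ = ∀ {ρ ρ′} → ρ ≗ ρ′ → Sat M ρ ψ → Sat M ρ′ ψ

flatBody-respects : ∀ {α βs} (a : Basic α) (bs : All Basic βs) M i → Respects≗ M (flatBody α βs i)
flatBody-respects a bs M i {ρ} {ρ′} e s =
  let p , c = from (flatBody⇔ a bs M ρ i) s in
  to (flatBody⇔ a bs M ρ′ i)
    (to (⟦⟧-ext (proj₁ (basic a)) (cellEnv-cong M e)) p , λ j → counted-cong (counters bs j) _ e (c j))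

exs-respects : ∀ {M ψ} K → Respects≗ M ψ → Respects≗ M (exs K ψ)
exs-respects zero    r e s       = r e s
exs-respects (suc K) r e (x , s) = x , exs-respects K r (∷ᵉ-cong x e) s

strip-exs : ∀ {M ψ} K {ρ} → Sat M ρ (exs K ψ) → ∃ λ ρ′ → Sat M ρ′ ψ
strip-exs zero    s       = _ , s
strip-exs (suc K) (x , s) = strip-exs K s

-- For satisfiability the outer quantifiers are harmless: head and tail of an assignment become
-- witness and new assignment. They recombine only up to `≗`, hence the hypothesis.
add-exs : ∀ {M ψ} K {ρ} → Respects≗ M ψ → Sat M ρ ψ → ∃ λ ρ′ → Sat M ρ′ (exs K ψ)
add-exs zero    r s = _ , s
add-exs (suc K) r s with add-exs K r s
... | ρ , s′ = ρ ∘ suc , ρ 0 , exs-respects K r (λ { zero → refl ; (suc i) → refl }) s′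

-- Deciding existential statements about finitely many cells

-- A total map that is the identity up to `n`; the values above `n` are arbitrary.
clip : ∀ n → ℕ → Fin (suc n)
clip n i = i ℕ.mod suc n

toℕ-clip : ∀ {n i} → i ℕ.≤ n → toℕ (clip n i) ≡ i
toℕ-clip {n} {i} i≤n = trans (toℕ-fromℕ< _) (ℕ.m<n⇒m%n≡m (ℕ.s≤s i≤n))

encode : Cell → ℕ × ℕ
encode (cPar k)   = 0 , k
encode (cVar i)   = 1 , i
encode cN         = 2 , 0
encode (cell a y) = 3 ℕ.+ a , y

decode : ℕ × ℕ → Cell
decode (0 , k)                   = cPar k
decode (1 , i)                   = cVar i
decode (2 , _)                   = cN
decode (suc (suc (suc a)) , y)   = cell a y

decode-encode : ∀ c → decode (encode c) ≡ c
decode-encode (cPar k)   = refl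
decode-encode (cVar i)   = refl
decode-encode cN         = refl
decode-encode (cell a y) = refl

codeSize : Cell → ℕ
codeSize c = proj₁ (encode c) ℕ.⊔ proj₂ (encode c)

-- Only cells of bounded code size matter, so a finite tuple can replace the environment. Larger
-- cells may share its entries through `enc`, since the formula does not see them.
∃-dec : {P : Env Cell → Set} → Def P → Dec (∃ P)
∃-dec {P} D = Dec.map′
  (λ { (u , p) → u ∘ enc , to (formula-⇔ D _) p })
  (λ { (w , p) → w ∘ dec , from (⟦⟧-agree φ ℕₚ.≤-refl (λ c c≤ → cong w (dec-enc c c≤))) (from (formula-⇔ D _) p) })
  -- After elimination the formula is closed and is evaluated in the empty environment.
  (def-dec E λ ())
  where
  φ = formula D
  open Bounded codeSize
  n = bound φ
  enc : Cell → Fin (suc n ℕ.* suc n)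
  enc c = combine (clip n (proj₁ (encode c))) (clip n (proj₂ (encode c)))
  unpair : Fin (suc n) × Fin (suc n) → Cell
  unpair (i , j) = decode (toℕ i , toℕ j)
  dec : Fin (suc n ℕ.* suc n) → Cell
  dec i = unpair (remQuot (suc n) i)
  dec-enc : ∀ c → codeSize c ℕ.≤ n → dec (enc c) ≡ c
  dec-enc c c≤ = trans (cong unpair (remQuot-combine (clip n (proj₁ (encode c))) (clip n (proj₂ (encode c)))))
    (trans (cong₂ (λ i j → decode (i , j)) (toℕ-clip (ℕₚ.m⊔n≤o⇒m≤o _ _ c≤)) (toℕ-clip (ℕₚ.m⊔n≤o⇒n≤o _ _ c≤)))
           (decode-encode c))
  E : Def {⊥} (λ w → ∃ λ (u : Fin (suc n ℕ.* suc n) → ℤ) → ⟦ φ ⟧ (u ∘ enc))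
  E = d-∃Fin (suc n ℕ.* suc n) {P = λ w → ⟦ φ ⟧ (λ c → w (inj₁ (enc c)))}
        (d-sub (λ c → l-at (inj₁ (enc c))) (d-qf φ))

-- Realising counts by arrays

bits : ∀ K → List (Vec Bool K)
bits zero    = [] ∷ []
bits (suc K) = map (true ∷_) (bits K) ++ map (false ∷_) (bits K)

∈-bits : ∀ {K} (τ : Vec Bool K) → τ ∈ bits K
∈-bits []          = here refl
∈-bits (true ∷ τ)  = ∈-++⁺ˡ (∈-map⁺ (true ∷_) (∈-bits τ))
∈-bits (false ∷ τ) = ∈-++⁺ʳ _ (∈-map⁺ (false ∷_) (∈-bits τ))

Bit : Bool → Set → Set
Bit true  P = P
Bit false P = ¬ P

bit : Bool → ℤ
bit true  = 1ℤ
bit false = 0ℤ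

bit-map : ∀ b {P Q : Set} → P ⇔ Q → Bit b P → Bit b Q
bit-map true  e = to e
bit-map false e = _∘ from e

bit-does : {P : Set} (d : Dec P) → Bit (does d) P
bit-does (yes p) = p
bit-does (no ¬p) = ¬p

d-Bit : {V : Set} {P : Env V → Set} → ∀ b → Def P → Def (λ w → Bit b (P w))
d-Bit true  D = D
d-Bit false D = d-¬ D

rulesOf : {A V : Set} {P : A → Env (Maybe V) → Set} → (∀ a → Def (P a)) → List A → Rules A V
rulesOf D = map (λ a → a , formula (D a))

step-rulesOf : {A V : Set} {P : A → Env (Maybe V) → Set} (D : ∀ a → Def (P a)) {as : List A} {a : A} →
               a ∈ as → ∀ {w x} → Step (rulesOf D as) w x a ⇔ P a (x ▸ w)
step-rulesOf {P = P} D {as} {a} a∈ {w} {x} =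
  mk⇔ f (λ p → formula (D a) , ∈-map⁺ (λ a → a , formula (D a)) a∈ , from (formula-⇔ (D a) (x ▸ w)) p)
  where
  f : Step (rulesOf D as) w x a → P a (x ▸ w)
  f (χ , i , p) with ∈-map⁻ (λ a → a , formula (D a)) i
  ... | _ , _ , refl = to (formula-⇔ (D a) (x ▸ w)) p

sup : ∀ {K} → (Fin K → ℕ) → ℕ
sup {zero}  f = 0
sup {suc K} f = f zero ℕ.⊔ sup (f ∘ suc)

≤-sup : ∀ {K} (f : Fin K → ℕ) j → f j ℕ.≤ sup f
≤-sup f zero    = ℕₚ.m≤m⊔n _ _
≤-sup f (suc j) = ℕₚ.≤-trans (≤-sup (f ∘ suc) j) (ℕₚ.m≤n⊔m (f zero) _)

walk-downFrom : {A : Set} {R : ℤ → A → Set} (f : ℕ → A) → (∀ i → R (+ i) (f i)) → ∀ n → Walk R 0ℤ (applyDownFrom f n)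
walk-downFrom f r zero    = []
walk-downFrom {R = R} f r (suc n) =
  subst (λ l → R (+ l) (f n)) (sym (length-applyDownFrom f n)) (r n) ∷ walk-downFrom f r n

count⇒total : {A : Set} {P : ℕ → Set} (f : ℕ → A) (b : A → Bool) → (∀ i → Bit (b (f i)) (P i)) →
              ∀ {n k} → Count P n k → + k ≡ total (bit ∘ b) (applyDownFrom f n)
count⇒total f b h c-zero = refl
count⇒total f b h (c-yes {n} p c) with b (f n) | h n
... | true  | _  = cong (_+_ 1ℤ) (count⇒total f b h c)
... | false | ¬p = contradiction p ¬p
count⇒total f b h (c-no {n} ¬p c) with b (f n) | h n
... | true  | p = contradiction p ¬p
... | false | _ = trans (count⇒total f b h c) (sym (ℤₚ.+-identityˡ _))

-- Walks and `Count` run alike: the outermost constructor of each concerns the greatest position.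
walk⇒count : {A : Set} {P : ℤ → Set} (b : A → Bool) {as : List A} → Walk (λ x a → Bit (b a) (P x)) 0ℤ as →
             ∃ λ k → total (bit ∘ b) as ≡ + k × Count (λ n → P (+ n)) (length as) k
walk⇒count b [] = 0 , refl , c-zero
walk⇒count b (_∷_ {a} r p) with b a | r | walk⇒count b p
... | true  | q  | k , e , c = suc k , cong (_+_ 1ℤ) e , c-yes q c
... | false | ¬q | k , e , c = k , trans (ℤₚ.+-identityˡ _) e , c-no ¬q c

-- Finite choice: the witnesses at the single positions are gathered into one function of the
-- position, from which the arrays will be read off. `u₀` is its value off the range.
walk-choice : {A U : Set} {R : ℤ → A → U → Set} {lo : ℤ} {as : List A} → U →
              Walk (λ x a → ∃ (R x a)) lo as → ∃ λ (g : ℤ → U) → Walk (λ x a → R x a (g x)) lo as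
walk-choice u₀ [] = (λ _ → u₀) , []
walk-choice {A} {U} {R} {lo} u₀ (_∷_ {a} {as} (u , r) p) with walk-choice {A} {U} {R} u₀ p
... | g , q = g′ , top ∷ walk-map rest q
  where
  g′ : ℤ → U
  g′ x with x ℤₚ.≟ lo + + length as
  ... | yes _ = u
  ... | no _  = g x
  top : R (lo + + length as) a (g′ (lo + + length as))
  top with lo + + length as ℤₚ.≟ lo + + length as
  ... | yes _ = r
  ... | no ≢  = contradiction refl ≢
  rest : ∀ x a → InRange lo (lo + + length as) x → R x a (g x) → R x a (g′ x)
  rest x a (_ , x<) r with x ℤₚ.≟ lo + + length as
  ... | yes e = contradiction x< (ℤₚ.<-irrefl e)
  ... | no _  = r

walk-at : {A : Set} {R : ℤ → A → Set} {lo : ℤ} {as : List A} → Walk R lo as →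
          ∀ {x} → InRange lo (lo + + length as) x → ∃ (R x)
walk-at {lo = lo} [] (p , q) = contradiction (subst (_ <_) (ℤₚ.+-identityʳ lo) q) (ℤₚ.≤⇒≯ p)
walk-at {R = R} {lo} (_∷_ {a} {as} r w) {x} (p , q) with x ℤₚ.≟ lo + + length as
... | yes e = a , subst (λ x → R x a) (sym e) r
... | no ≢  = walk-at w (p , ℤₚ.≤∧≢⇒< (<1+⇒≤ (subst (x <_) (e lo (+ length as)) q)) ≢)
  where
  e : ∀ lo n → lo + (1ℤ + n) ≡ 1ℤ + (lo + n)
  e = solve-∀

clamp-inRange : ∀ {i n} → 0ℤ ≤ i → i < n → i < + clamp n
clamp-inRange {n = + _}      _ i<  = i<
clamp-inRange {n = -[1+ _ ]} p q = contradiction (≤-<-trans p q) λ ()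

clamp-inRange⁻ : ∀ {i n} → 0ℤ ≤ i → i < + clamp n → i < n
clamp-inRange⁻ {n = + _}      _ i< = i<
clamp-inRange⁻ {n = -[1+ _ ]} p q = contradiction (≤-<-trans p q) (ℤₚ.<-irrefl refl)

if-yes : {P A : Set} (d : Dec P) {x y : A} → P → (if does d then x else y) ≡ x
if-yes (yes _) p = refl
if-yes (no ¬p) p = contradiction p ¬p

if-no : {P A : Set} (d : Dec P) {x y : A} → ¬ P → (if does d then x else y) ≡ y
if-no (yes p) ¬p = contradiction p ¬p
if-no (no _)  ¬p = refl

-- `clamp` is replaced by a case distinction on the sign, which the language can express.
clamp-cases : (R : ℤ → Set) → ∀ n → (0ℤ ≤ n × R n ⊎ n < 0ℤ × R 0ℤ) ⇔ R (+ clamp n)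
clamp-cases R (+ k)    = mk⇔ (λ { (inj₁ (_ , r)) → r ; (inj₂ (ℤ.+<+ () , _)) }) (λ r → inj₁ (+≤+ ℕ.z≤n , r))
clamp-cases R -[1+ k ] = mk⇔ (λ { (inj₁ (() , _)) ; (inj₂ (_ , r)) → r }) (λ r → inj₂ (ℤ.-<+ , r))

-- Flat bodies as conditions on cells

-- Parameters and variables pass unchanged between models and environments and get size 0; only
-- array reads have to be bounded.
cellIndex : Cell → ℕ
cellIndex (cell a y) = a ℕ.⊔ y
cellIndex _          = 0

module Decide {K : ℕ} (α : QF Cell) (β : Fin K → QF Cell) where

  open Bounded cellIndex

  n m : ℕ
  n = bound α ℕ.⊔ sup (bound ∘ β)
  m = suc n

  β≤n : ∀ j → bound (β j) ℕ.≤ n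
  β≤n j = ℕₚ.≤-trans (≤-sup (bound ∘ β) j) (ℕₚ.m≤n⊔m (bound α) _)

  -- One of two conditions for an environment to come from arrays. The other is the second clause of
  -- `Profile`: it ties a(y), for y in range, to the column at that position, so equal y get equal
  -- values.
  OutOfRangeZero : Env Cell → Set
  OutOfRangeZero w = ∀ (a y : Fin m) → (w (cVar (toℕ y)) < 0ℤ ⊎ w cN ≤ w (cVar (toℕ y))) →
                     w (cell (toℕ a) (toℕ y)) ≡ 0ℤ

  -- The environment under the binder of ♯: x is variable 0 and u a is the value of a at x.
  atPosition : (Fin m → ℤ) → ℤ → Env Cell → Env Cell
  atPosition u x w (cPar k)         = w (cPar k)
  atPosition u x w cN               = w cN
  atPosition u x w (cVar zero)      = x
  atPosition u x w (cVar (suc i))   = w (cVar i)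
  atPosition u x w (cell a zero)    = u (clip n a)
  atPosition u x w (cell a (suc y)) = w (cell a y)

  -- Quantifying `u` away gives the formula χ_τ(x, w); `u` is the column of array values at x.
  Profile : Env Cell → ℤ → Vec Bool K → (Fin m → ℤ) → Set
  Profile w x τ u =
      (∀ j → Bit (Vec.lookup τ j) (⟦ β j ⟧ (atPosition u x w)))
    × (∀ (y : Fin m) → x ≡ w (cVar (toℕ y)) → ∀ a → u a ≡ w (cell (toℕ a) (toℕ y)))

  d-Profile : ∀ τ → Def {Maybe Cell} (λ w → ∃ (Profile (w ∘ just) (w nothing) τ))
  d-Profile τ = d-∃Fin m {P = λ w → Profile (w ∘ inj₂ ∘ just) (w (inj₂ nothing)) τ (w ∘ inj₁)}
    (d-× (d-∀Fin λ j → d-Bit (Vec.lookup τ j) (d-sub position-Lin (d-qf (β j))))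
         (d-∀Fin λ y → d-→ (d-≡ x (l-at (inj₂ (just (cVar (toℕ y))))))
                           (d-∀Fin λ a → d-≡ (l-at (inj₁ a)) (l-at (inj₂ (just (cell (toℕ a) (toℕ y))))))))
    where
    x : Lin {Fin m ⊎ Maybe Cell} (λ w → w (inj₂ nothing))
    x = l-at (inj₂ nothing)
    position-Lin : ∀ c → Lin {Fin m ⊎ Maybe Cell} (λ w → atPosition (w ∘ inj₁) (w (inj₂ nothing)) (w ∘ inj₂ ∘ just) c)
    position-Lin (cPar k)         = l-at (inj₂ (just (cPar k)))
    position-Lin cN               = l-at (inj₂ (just cN))
    position-Lin (cVar zero)      = x
    position-Lin (cVar (suc i))   = l-at (inj₂ (just (cVar i)))
    position-Lin (cell a zero)    = l-at (inj₁ (clip n a))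
    position-Lin (cell a (suc y)) = l-at (inj₂ (just (cell a y)))

  rules : Rules (Vec Bool K) Cell
  rules = rulesOf d-Profile (bits K)

  step⇔profile : ∀ w x τ → Step rules w x τ ⇔ ∃ (Profile w x τ)
  step⇔profile w x τ = step-rulesOf d-Profile (∈-bits τ)

  weight : Weight {K} (Vec Bool K)
  weight τ j = bit (Vec.lookup τ j)

  target : Env Cell → Fin K → ℤ
  target w j = w (cVar (countVar 0 j))

  Profiled : Env Cell → ℤ → Set
  Profiled w hi = ∃ λ τs → Walk (λ x τ → ∃ (Profile w x τ)) 0ℤ τs × 0ℤ + + length τs ≡ hi × Totals weight τs (target w)

  d-Profiled : {hi : Env Cell → ℤ} → Lin hi → Def (λ w → Profiled w (hi w))
  d-Profiled H = d-resp
    (λ w → mk⇔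
      (λ { (τs , p , r) → τs , walk-map (λ x τ _ → to (step⇔profile w x τ)) p , r })
      (λ { (τs , p , r) → τs , walk-map (λ x τ _ → from (step⇔profile w x τ)) p , r }))
    (d-Reach weight rules H (λ j → l-at (cVar (countVar 0 j))))

  Abstract : Env Cell → Set
  Abstract w = ⟦ α ⟧ w × OutOfRangeZero w × Profiled w (+ clamp (w cN))

  d-Abstract : Def Abstract
  d-Abstract = d-× (d-qf α) (d-×
    (d-∀Fin λ a → d-∀Fin λ y → d-→ (d-⊎ (d-< (l-at (cVar (toℕ y))) (l-con 0ℤ)) (d-≤ (l-at cN) (l-at (cVar (toℕ y)))))
                                   (d-≡ (l-at (cell (toℕ a) (toℕ y))) (l-con 0ℤ)))
    (d-resp (λ w → clamp-cases (Profiled w) (w cN))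
      (d-⊎ (d-× (d-≤ (l-con 0ℤ) (l-at cN)) (d-Profiled (l-at cN)))
           (d-× (d-< (l-at cN) (l-con 0ℤ)) (d-Profiled (l-con 0ℤ))))))

  abstraction : ∀ M ρ → ArraysOK M → FlatSat M ρ α β 0 → Abstract (cellEnv M ρ)
  abstraction M ρ ok (p , c) = p , (λ a y → ok (toℕ a) (ρ (toℕ y))) ,
    applyDownFrom τ L , walk-downFrom τ profile L ,
    cong +_ (length-applyDownFrom τ L) ,
    λ j → let k , e , cnt = c j in trans e (count⇒total τ (λ τ → Vec.lookup τ j) (τ-bit j) cnt)
    where
    w = cellEnv M ρ
    L = clamp (N M)
    holds? : ∀ i j → Dec (⟦ β j ⟧ (cellEnv M ((+ i) ∷ᵉ ρ)))
    holds? i j = ⟦ β j ⟧? (cellEnv M ((+ i) ∷ᵉ ρ))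
    τ : ℕ → Vec Bool K
    τ i = Vec.tabulate (λ j → does (holds? i j))
    τ-bit : ∀ j i → Bit (Vec.lookup (τ i) j) (⟦ β j ⟧ (cellEnv M ((+ i) ∷ᵉ ρ)))
    τ-bit j i = subst (λ b → Bit b _) (sym (lookup∘tabulate (λ j → does (holds? i j)) j)) (bit-does (holds? i j))
    u : ℕ → Fin m → ℤ
    u i a = arrays M (toℕ a) (+ i)
    same : ∀ i → AgreeUpTo n (cellEnv M ((+ i) ∷ᵉ ρ)) (atPosition (u i) (+ i) w)
    same i (cPar k)         _  = refl
    same i cN               _  = refl
    same i (cVar zero)      _  = refl
    same i (cVar (suc k))   _  = refl
    same i (cell a zero)    a≤ = cong (λ a → arrays M a (+ i)) (sym (toℕ-clip (ℕₚ.m⊔n≤o⇒m≤o a 0 a≤)))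
    same i (cell a (suc y)) _  = refl
    profile : ∀ i → ∃ (Profile w (+ i) (τ i))
    profile i = u i , (λ j → bit-map _ (⟦⟧-agree (β j) (β≤n j) (same i)) (τ-bit j i)) ,
                λ y e a → cong (arrays M (toℕ a)) e

  -- One column is chosen at each position and the columns are read as arrays. Each position in
  -- range carries a profile, which makes the arrays return the prescribed values a(y).
  realisation : ∀ w → Abstract w → ∃₂ λ M ρ → ArraysOK M × FlatSat M ρ α β 0
  realisation w (p , out , as , steps , l , t) = M , ρ , ok ,
    to (⟦⟧-agree α (ℕₚ.m≤m⊔n _ _) same) p ,
    λ j → let k , e , c = walk⇒count {P = holds j} (λ τ → Vec.lookup τ j) (position-bits j) in
          k , trans (t j) e , subst (λ L → Count (holds j ∘ +_) L k) (ℤₚ.+-injective l) c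
    where
    ρ : ℕ → ℤ
    ρ i = w (cVar i)
    chosen = walk-choice {R = Profile w} (λ _ → 0ℤ) steps
    g = proj₁ chosen
    walk = proj₂ chosen
    inside? : ∀ i → Dec (0ℤ ≤ i × i < w cN)
    inside? i = (0ℤ ℤₚ.≤? i) ×-dec (i ℤₚ.<? w cN)
    M : Model
    M = record { params = λ k → w (cPar k) ; N = w cN
               -- Array-ids above `n` wrap around to other entries of the column; the formulae do
               -- not mention them.
               ; arrays = λ a i → if does (inside? i) then g i (clip n a) else 0ℤ }
    inside : ∀ a i → 0ℤ ≤ i → i < w cN → arrays M a i ≡ g i (clip n a)
    inside a i 0≤i i<N = if-yes (inside? i) (0≤i , i<N)
    ok : ArraysOK M
    ok a i (inj₁ i<0) = if-no (inside? i) (λ { (0≤i , _) → ℤₚ.<⇒≱ i<0 0≤i })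
    ok a i (inj₂ N≤i) = if-no (inside? i) (λ { (_ , i<N) → ℤₚ.<⇒≱ i<N N≤i })
    end : 0ℤ + + length as ≡ + clamp (w cN)
    end = l
    cell-value : ∀ a y → a ℕ.≤ n → y ℕ.≤ n → w (cell a y) ≡ arrays M a (ρ y)
    cell-value a y a≤ y≤ with inside? (ρ y)
    ... | no ¬p = trans zero-cell (sym (if-no (inside? (ρ y)) ¬p))
      where
      outside : ρ y < 0ℤ ⊎ w cN ≤ ρ y
      outside with 0ℤ ℤₚ.≤? ρ y
      ... | no 0≰  = inj₁ (≰⇒> 0≰)
      ... | yes 0≤ = inj₂ (≮⇒≥ (λ <N → ¬p (0≤ , <N)))
      zero-cell : w (cell a y) ≡ 0ℤ
      zero-cell = subst₂ (λ a y → w (cell a y) ≡ 0ℤ) (toℕ-clip a≤) (toℕ-clip y≤)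
        (out (clip n a) (clip n y) (subst (λ y → ρ y < 0ℤ ⊎ w cN ≤ ρ y) (sym (toℕ-clip y≤)) outside))
    ... | yes (0≤ , <N) with walk-at walk (0≤ , subst (ρ y <_) (sym end) (clamp-inRange 0≤ <N))
    ...   | τ , _ , consistent = sym (trans (inside a (ρ y) 0≤ <N)
              (trans (consistent (clip n y) (cong ρ (sym (toℕ-clip y≤))) (clip n a))
                (cong₂ (λ a y → w (cell a y)) (toℕ-clip a≤) (toℕ-clip y≤))))
    same : AgreeUpTo n w (cellEnv M ρ)
    same (cPar k)   _ = refl
    same cN         _ = refl
    same (cVar i)   _ = refl
    same (cell a y) b = cell-value a y (ℕₚ.m⊔n≤o⇒m≤o a y b) (ℕₚ.m⊔n≤o⇒n≤o a y b)
    position-same : ∀ x → InRange 0ℤ (0ℤ + + length as) x →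
                    AgreeUpTo n (atPosition (g x) x w) (cellEnv M (x ∷ᵉ ρ))
    position-same x _         (cPar k)         _ = refl
    position-same x _         cN               _ = refl
    position-same x _         (cVar zero)      _ = refl
    position-same x _         (cVar (suc i))   _ = refl
    position-same x (0≤ , <L) (cell a zero)    _ = sym (inside a x 0≤ (clamp-inRange⁻ 0≤ (subst (x <_) end <L)))
    -- Under the binder of ♯ the variable y has index y + 1, so the bound on `suc y` also covers y.
    position-same x _         (cell a (suc y)) b =
      cell-value a y (ℕₚ.m⊔n≤o⇒m≤o a (suc y) b) (ℕₚ.<⇒≤ (ℕₚ.m⊔n≤o⇒n≤o a (suc y) b))
    holds : Fin K → ℤ → Set
    holds j x = ⟦ β j ⟧ (cellEnv M (x ∷ᵉ ρ))
    position-bits : ∀ j → Walk (λ x τ → Bit (Vec.lookup τ j) (holds j x)) 0ℤ as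
    position-bits j = walk-map
      (λ x τ i pr → bit-map (Vec.lookup τ j) (⟦⟧-agree (β j) (β≤n j) (position-same x i)) (proj₁ pr j)) walk

  flatSat? : Dec (∃₂ λ M ρ → ArraysOK M × FlatSat M ρ α β 0)
  flatSat? = Dec.map′ (λ { (w , a) → realisation w a })
                      (λ { (M , ρ , ok , s) → cellEnv M ρ , abstraction M ρ ok s })
                      (∃-dec d-Abstract)

theorem2 : (φ : Formula) → EFlat φ → Dec (Satisfiable φ)
theorem2 φ (α , βs , a , bs , refl) = Dec.map′
  (λ { (M , ρ , ok , s) →
       let ρ′ , s′ = add-exs (length βs) (flatBody-respects a bs M 0) (to (flatBody⇔ a bs M ρ 0) s)
       in M , ρ′ , ok , s′ })
  (λ { (M , ρ , ok , s) →
       let ρ′ , s′ = strip-exs (length βs) s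
       in M , ρ′ , ok , from (flatBody⇔ a bs M ρ′ 0) s′ })
  (Decide.flatSat? (proj₁ (basic a)) (counters bs))
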